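{- Let $f=\mathrm{Path}_n$ be the $s$-$t$ path polynomial. Then $\mathrm{D}(f)=O(n^3)$, but $\mathrm{C}_{0/1}(f)\geq 2^{n^{\Omega(1)}}$.
   Context: The $s$-$t$ path polynomial $\mathrm{Path}_n$ has one variable $x_{i,j}$ for each edge of the complete undirected graph on the $n+2$ nodes $\{s,1,2,\ldots,n,t\}$ (so $x_{i,j}=x_{j,i}$), and each of its monomials corresponds to a simple directed path from $s$ to $t$: \[ \mathrm{Path}_n(x)=x_{s,t}+\sum_{l=1}^n\ \sum_{\substack{i_1,\ldots,i_l\in\{1,\ldots,n\}\\ \text{distinct}}} x_{s,i_1}x_{i_1,i_2}\cdots x_{i_{l-1},i_l}x_{i_l,t}. \] A $\{+,\times\}$-circuit is a directed acyclic graph whose input nodes (fanin $0$) are labelled by variables and whose other nodes, called gates, have fanin two and are labelled $+$ or $\times$; its size is the number of gates. Syntactically (formally, expanding by distributivity) the circuit produces at each node a polynomial: the variable itself at an input, and the sum (product) of the polynomials produced at its two inputs at a $+$ ($\times$) gate. The polynomial $F$ produced by the circuit is the one produced at its output. For a polynomial $f$ in $N$ variables with nonnegative integer coefficients, the circuit counts $f$ if $F(a)=f(a)$ for all $a\in\{0,1\}^N$, and decides $f$ if for all $a\in\{0,1\}^N$, $F(a)=0$ holds exactly when $f(a)=0$. $\mathrm{C}_{0/1}(f)$ and $\mathrm{D}(f)$ denote the minimum sizes of a $\{+,\times\}$-circuit counting $f$, respectively deciding $f$. -}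

module Defs where

open import Data.Nat.Base using (ℕ; zero; suc; _+_; _*_; _^_; _≤_; NonZero)
open import Data.Nat.ListAction using (sum; product)
open import Data.Fin.Base using (Fin; zero; suc; toℕ; fromℕ; inject₁; _<_)
open import Data.Fin.Properties using (_≟_; <-cmp)
open import Data.List.Base
  using (List; []; _∷_; [_]; _++_; map; concatMap; cartesianProductWith;
         allFin; upTo)
open import Data.List.Relation.Unary.All using (_∷_)
open import Data.List.Relation.Unary.AllPairs using (_∷_)
open import Data.List.Relation.Unary.Unique.Propositional using (Unique)
open import Data.List.Relation.Unary.Unique.DecPropositional using (unique?)
open import Data.Product.Base using (_×_; ∃-syntax)
open import Data.Sum.Base using (_⊎_; inj₁; inj₂)
open import Function.Base using (_∘_)
open import Function.Bundles using (_⇔_)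
open import Relation.Binary.Definitions using (tri<; tri≈; tri>)
open import Relation.Binary.PropositionalEquality.Core using (_≡_; _≢_)
open import Relation.Nullary.Decidable.Core using (yes; no)
open import Relation.Nullary.Negation.Core using (contradiction)

-- A polynomial with coefficients in ℕ is a formal sum of monomials, the
-- coefficient of a monomial being the number of times it is listed; a monomial
-- is the list of its variables, the exponent being the number of occurrences.

Monomial : Set → Set
Monomial V = List V

Poly : Set → Set
Poly V = List (Monomial V)

module _ {V : Set} where

  var : V → Poly V
  var v = [ [ v ] ]

  infixl 6 _⊕_
  infixl 7 _⊗_

  _⊕_ : Poly V → Poly V → Poly V
  _⊕_ = _++_

  _⊗_ : Poly V → Poly V → Poly V
  _⊗_ = cartesianProductWith _++_

  eval : Poly V → (V → ℕ) → ℕ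
  eval p a = sum (map (product ∘ map a) p)

  -- The value of a polynomial at a point of {0,1}^V.
  eval₀₁ : Poly V → (V → Fin 2) → ℕ
  eval₀₁ p a = eval p (toℕ ∘ a)

-- Circuits are listed in a topological order of their gates.  A wire comes
-- either from an input node, identified with its variable, or from one of the
-- k gates already listed.

data Op : Set where
  plus times : Op

Source : Set → ℕ → Set
Source V k = V ⊎ Fin k

record Gate (V : Set) (k : ℕ) : Set where
  constructor gate
  field
    op    : Op
    left  : Source V k
    right : Source V k

infixl 5 _▷_

data Gates (V : Set) : ℕ → Set where
  []  : Gates V 0
  _▷_ : ∀ {k} → Gates V k → Gate V k → Gates V (suc k)

record Circuit (V : Set) : Set where
  constructor circuit
  field
    {size} : ℕ
    gates  : Gates V size
    output : Source V size

open Circuit public using (size)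

module _ {V : Set} where

  combine : Op → Poly V → Poly V → Poly V
  combine plus  = _⊕_
  combine times = _⊗_

  -- Index zero refers to the gate listed last.
  producedAt : ∀ {k} → Gates V k → Source V k → Poly V
  producedAt gs       (inj₁ v)       = var v
  producedAt (gs ▷ g) (inj₂ zero)    =
    combine (Gate.op g) (producedAt gs (Gate.left g)) (producedAt gs (Gate.right g))
  producedAt (gs ▷ g) (inj₂ (suc i)) = producedAt gs (inj₂ i)

  produced : Circuit V → Poly V
  produced C = producedAt (Circuit.gates C) (Circuit.output C)

  Counts : Circuit V → Poly V → Set
  Counts C f = ∀ a → eval₀₁ (produced C) a ≡ eval₀₁ f a

  Decides : Circuit V → Poly V → Set
  Decides C f = ∀ a → eval₀₁ (produced C) a ≡ 0 ⇔ eval₀₁ f a ≡ 0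

  -- A minimum is at most k iff it ranges over some value that is at most k,
  -- and at least r iff all the values it ranges over are at least r.

  D[_]≤_ : Poly V → ℕ → Set
  D[ f ]≤ k = ∃[ C ] Decides C f × size C ≤ k

  -- r is a real number given by its upper set {m ∈ ℕ : r ≤ m}.
  C₀₁[_]≥_ : Poly V → (ℕ → Set) → Set
  C₀₁[ f ]≥ r = ∀ C → Counts C f → r (size C)

-- The upper set of the real number 2 ^ (n ^ (a / b)), for a, b ≥ 1.
-- By density of ℚ and continuity, 2 ^ (n ^ (a / b)) ≤ m holds iff
-- 2 ^ (p / q) ≤ m for all rationals p / q ≤ n ^ (a / b).
2^[_^[_/_]] : ℕ → ℕ → ℕ → ℕ → Set
2^[ n ^[ a / b ]] m =
  ∀ p q → .{{NonZero q}} → p ^ b ≤ n ^ a * q ^ b → 2 ^ p ≤ m ^ q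

-- Edges of the complete undirected graph on Fin m: the unordered pair of
-- distinct nodes is represented by its increasing enumeration.
record Edge (m : ℕ) : Set where
  constructor edge
  field
    lo hi  : Fin m
    .lo<hi : lo < hi

[_—_]⟨_⟩ : ∀ {m} (u v : Fin m) → u ≢ v → Edge m
[ u — v ]⟨ u≢v ⟩ with <-cmp u v
... | tri< u<v _ _ = edge u v u<v
... | tri≈ _ u≡v _ = contradiction u≡v u≢v
... | tri> _ _ v<u = edge v u v<u

pathMonomial : ∀ {m} (vs : List (Fin m)) → Unique vs → Monomial (Edge m)
pathMonomial []           _                   = []
pathMonomial (u ∷ [])     _                   = []
pathMonomial (u ∷ v ∷ vs) ((u≢v ∷ _) ∷ v∷vs!) =
  [ u — v ]⟨ u≢v ⟩ ∷ pathMonomial (v ∷ vs) v∷vs!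

-- The zero polynomial if a node is repeated.
pathPoly : ∀ {m} → List (Fin m) → Poly (Edge m)
pathPoly vs with unique? _≟_ vs
... | yes vs! = [ pathMonomial vs vs! ]
... | no  _   = []

words : {A : Set} → List A → ℕ → List (List A)
words as zero    = [ [] ]
words as (suc l) = cartesianProductWith _∷_ as (words as l)

-- The nodes s, 1, …, n, t are numbered 0, 1, …, n, n + 1.

module _ {n : ℕ} where

  s t : Fin (2 + n)
  s = zero
  t = suc (fromℕ n)

  inner : Fin n → Fin (2 + n)
  inner i = suc (inject₁ i)

-- The summand l = 0 is the monomial x_{s,t}.
Path : (n : ℕ) → Poly (Edge (2 + n))
Path n = concatMap
  (λ l → concatMap (λ is → pathPoly (s ∷ map inner is ++ [ t ])) (words (allFin n) l))
  (upTo (suc n))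

{-# OPTIONS --safe #-}
module Submission where

-- Lower bound.  A circuit counting f has, as a list of sets of variables, the
-- same monomials as f: a minimal set on one side occurs on the other
-- side, and both copies can be removed.  Let P_σ be the path
-- s, σ₁, r₁, σ₂, r₂, …, σ_N, r_N, t for a permutation σ of N fixed columns and
-- N fixed rows.  Descending from the output to the heavier factor, P_σ passes
-- through a gate at which the part a_σ produced so far has between κ and 2κ edges
-- of P_σ, the rest lying in a context c_σ.  If σ and τ use the same gate, then
-- a_τ ∪ c_σ is a path as well.  As c_σ contains all but 2κ edges of P_σ, degrees
-- force every edge of a_τ to lie on P_σ or to join two of the at most 4κ ends of
-- edges of a_σ.  For fixed σ with κ ≈ √N this leaves O(N) pairs (row, column), of
-- which τ has to hit k ≈ κ/2, so the gate serves at most N! · O(1)^k / k! of the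
-- N! permutations.
--
-- Upper bound.  Shortest paths by relaxation, ignoring that walks may repeat
-- nodes: a walk from s to t exists exactly if a simple path does.

open import Defs
open import Data.Empty using (⊥; ⊥-elim)
open import Data.Fin.Base using (Fin; zero; suc; toℕ)
open import Data.Fin.Properties using (_≟_; <-cmp; inject₁-injective; fromℕ≢inject₁) renaming (suc-injective to Fin-suc-injective)
open import Data.Fin.Relation.Unary.Top using (view; ‵fromℕ; ‵inject₁)
open import Data.List.Base using (List; []; _∷_; [_]; _++_; map; concatMap; length; zipWith; filter; take; drop; allFin; upTo; cartesianProduct)
open import Data.List.Membership.Propositional using (_∈_; _∉_; find; lose)
open import Data.List.Membership.Propositional.Properties using (∈-++⁺ˡ; ∈-++⁺ʳ; ∈-++⁻; ∈-∃++; ∈-map⁺; ∈-map⁻; ∈-concatMap⁺; ∈-concatMap⁻; ∈-cartesianProduct⁺; ∈-cartesianProductWith⁺; ∈-cartesianProductWith⁻; ∈-allFin; ∈-upTo⁺; ∈-filter⁺)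
open import Data.List.Properties using (++-identityʳ; ++-assoc; ++-conicalˡ; ++-conicalʳ; filter-all; filter-none; length-++; length-map; length-take; length-drop; length-tabulate; map-cong; map-++; map-∘; take-[])
open import Data.List.Relation.Binary.Permutation.Propositional using (_↭_; prep; swap; ↭-refl; ↭-trans; ↭-sym; ↭⇒↭ₛ)
open import Data.List.Relation.Binary.Permutation.Propositional.Properties using (↭-length; shift; ∈-resp-↭; ++-comm; ++⁺ʳ; map⁺)
open import Data.List.Relation.Binary.Subset.Propositional using (_⊆_)
open import Data.List.Relation.Binary.Subset.Propositional.Properties using (⊆-refl; ⊆-trans; ++⁺; ⊆-reflexive-↭)
open import Data.List.Relation.Unary.All using (All; []; _∷_; lookup; tabulate)
open import Data.List.Relation.Unary.AllPairs using ([]; _∷_)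
open import Data.List.Relation.Unary.Any using (here; there)
open import Data.List.Relation.Unary.Unique.DecPropositional using (unique?)
open import Data.List.Relation.Unary.Unique.Propositional using (Unique)
open import Data.List.Relation.Unary.Unique.Propositional.Properties using (allFin⁺; take⁺; drop⁺) renaming (map⁺ to Unique-map⁺; ++⁺ to Unique-++⁺)
open import Data.Nat.Base
open import Data.Nat.ListAction using (sum; product)
open import Data.Nat.ListAction.Properties using (sum-++; sum-↭)
open import Data.Nat.Properties hiding (_≟_; <-cmp)
open import Data.Nat.Properties using () renaming (_≟_ to _≟ᴺ_)
open import Data.Nat.Tactic.RingSolver using (solve-∀)
open import Data.Product.Base using (_×_; _,_; ∃-syntax; proj₁; proj₂; map₂)
open import Data.Sum.Base using (_⊎_; inj₁; inj₂)
open import Data.Unit.Base using (tt)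
open import Function.Base using (_∘_)
open import Function.Bundles using (mk⇔)
open import Relation.Binary.Definitions using (DecidableEquality; tri<; tri≈; tri>)
open import Relation.Binary.PropositionalEquality using (_≡_; _≢_; refl; sym; trans; cong; cong₂; subst; setoid; module ≡-Reasoning)
open import Relation.Nullary.Decidable.Core using (Dec; yes; no)
open import Relation.Nullary.Negation.Core using (contradiction)
import Data.List.Membership.DecPropositional as DecMembership
import Data.List.Relation.Binary.Permutation.Setoid.Properties as SetoidPermutation
import Data.List.Relation.Binary.Subset.DecPropositional as DecSubset

-- Finite sums over lists

∑ : {A : Set} → (A → ℕ) → List A → ℕ
∑ f xs = sum (map f xs)

module _ {A : Set} where

  ∑-cong : ∀ {f g : A → ℕ} → (∀ x → f x ≡ g x) → ∀ xs → ∑ f xs ≡ ∑ g xs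
  ∑-cong f≗g xs = cong sum (map-cong f≗g xs)

  ∑-mono : ∀ {f g : A → ℕ} xs → (∀ {x} → x ∈ xs → f x ≤ g x) → ∑ f xs ≤ ∑ g xs
  ∑-mono []       f≤g = z≤n
  ∑-mono (x ∷ xs) f≤g = +-mono-≤ (f≤g (here refl)) (∑-mono xs (f≤g ∘ there))

  ∑-++ : ∀ (f : A → ℕ) xs ys → ∑ f (xs ++ ys) ≡ ∑ f xs + ∑ f ys
  ∑-++ f xs ys = trans (cong sum (map-++ f xs ys)) (sum-++ (map f xs) (map f ys))

  ∑-↭ : ∀ (f : A → ℕ) {xs ys} → xs ↭ ys → ∑ f xs ≡ ∑ f ys
  ∑-↭ f xs↭ys = sum-↭ (map⁺ f xs↭ys)

  ∑-+ : ∀ (f g : A → ℕ) xs → ∑ (λ x → f x + g x) xs ≡ ∑ f xs + ∑ g xs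
  ∑-+ f g []       = refl
  ∑-+ f g (x ∷ xs) = trans (cong (f x + g x +_) (∑-+ f g xs)) (lemma (f x) (g x) (∑ f xs) (∑ g xs))
    where
    lemma : ∀ a b c d → a + b + (c + d) ≡ a + c + (b + d)
    lemma = solve-∀

  ∑-*ˡ : ∀ c (f : A → ℕ) xs → ∑ (λ x → c * f x) xs ≡ c * ∑ f xs
  ∑-*ˡ c f []       = sym (*-zeroʳ c)
  ∑-*ˡ c f (x ∷ xs) = trans (cong (c * f x +_) (∑-*ˡ c f xs)) (sym (*-distribˡ-+ c (f x) (∑ f xs)))

  ∑-*ʳ : ∀ c (f : A → ℕ) xs → ∑ (λ x → f x * c) xs ≡ ∑ f xs * c
  ∑-*ʳ c f xs = trans (∑-cong (λ x → *-comm (f x) c) xs) (trans (∑-*ˡ c f xs) (*-comm c _))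

  ∑-const : ∀ c (xs : List A) → ∑ (λ _ → c) xs ≡ length xs * c
  ∑-const c []       = refl
  ∑-const c (x ∷ xs) = cong (c +_) (∑-const c xs)

  ∑-zero : ∀ (xs : List A) → ∑ (λ _ → 0) xs ≡ 0
  ∑-zero xs = trans (∑-const 0 xs) (*-zeroʳ (length xs))

  ∑-bounded : ∀ {f : A → ℕ} c xs → (∀ x → f x ≤ c) → ∑ f xs ≤ length xs * c
  ∑-bounded {f} c xs f≤c = subst (∑ f xs ≤_) (∑-const c xs) (∑-mono xs (λ {x} _ → f≤c x))

  term≤∑ : ∀ (f : A → ℕ) {x xs} → x ∈ xs → f x ≤ ∑ f xs
  term≤∑ f (here refl)  = m≤m+n _ _
  term≤∑ f (there x∈xs) = m≤n⇒m≤o+n _ (term≤∑ f x∈xs)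

module _ {A B : Set} where

  ∑-map : ∀ (f : B → ℕ) (g : A → B) xs → ∑ f (map g xs) ≡ ∑ (f ∘ g) xs
  ∑-map f g xs = cong sum (sym (map-∘ xs))

  ∑-concatMap : ∀ (f : B → ℕ) (g : A → List B) xs →
                ∑ f (concatMap g xs) ≡ ∑ (∑ f ∘ g) xs
  ∑-concatMap f g []       = refl
  ∑-concatMap f g (x ∷ xs) =
    trans (∑-++ f (g x) (concatMap g xs)) (cong (∑ f (g x) +_) (∑-concatMap f g xs))

  ∑-swap : ∀ (f : A → B → ℕ) xs ys → ∑ (λ x → ∑ (f x) ys) xs ≡ ∑ (λ y → ∑ (λ x → f x y) xs) ys
  ∑-swap f []       ys = sym (∑-zero ys)
  ∑-swap f (x ∷ xs) ys =
    trans (cong (∑ (f x) ys +_) (∑-swap f xs ys)) (sym (∑-+ (f x) _ ys))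

-- Elementary symmetric polynomials and a binomial inequality

esym : ℕ → List ℕ → ℕ
esym zero    ws       = 1
esym (suc k) []       = 0
esym (suc k) (w ∷ ws) = w * esym k ws + esym (suc k) ws

esym-short : ∀ k ws → length ws < k → esym k ws ≡ 0
esym-short (suc k) []       _         = refl
esym-short (suc k) (w ∷ ws) (s≤s |ws|) =
  cong₂ _+_ (trans (cong (w *_) (esym-short k ws |ws|)) (*-zeroʳ w)) (esym-short (suc k) ws (m<n⇒m<1+n |ws|))

-- `1 ⊓ w` is the indicator of `w ≢ 0`, so this is the number of nonzero weights.
support : List ℕ → ℕ
support = ∑ (1 ⊓_)

-- Any `k` nonzero weights contribute a product of at least 1. This turns the condition of hitting
-- `k` suspect cells into a number that can be summed over all permutations.
esym-positive : ∀ k ws → k ≤ support ws → 1 ≤ esym k ws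
esym-positive zero    ws           _       = ≤-refl
esym-positive (suc k) (zero  ∷ ws) k<      = esym-positive (suc k) ws k<
esym-positive (suc k) (suc w ∷ ws) (s≤s k≤) =
  ≤-trans (esym-positive k ws k≤) (≤-trans (m≤m+n _ _) (m≤m+n _ _))

-- The left side consists of the two terms of the binomial expansion in which `d` has exponent at
-- most 1.
binomial-≤ : ∀ k d g → suc k * (d * g ^ k) + g ^ suc k ≤ (d + g) ^ suc k
binomial-≤ zero    d g = ≤-reflexive (lemma d g)
  where
  lemma : ∀ d g → 1 * (d * 1) + g * 1 ≡ (d + g) * 1
  lemma = solve-∀
binomial-≤ (suc k) d g = begin
  suc (suc k) * (d * (g * g ^ k)) + g * (g * g ^ k)
    ≡⟨ lemma k d g (g ^ k) ⟩
  d * (g * g ^ k) + g * (suc k * (d * g ^ k) + g * g ^ k)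
    ≤⟨ +-mono-≤ (*-monoʳ-≤ d (≤-trans (m≤n+m _ _) (binomial-≤ k d g))) (*-monoʳ-≤ g (binomial-≤ k d g)) ⟩
  d * (d + g) ^ suc k + g * (d + g) ^ suc k
    ≡⟨ *-distribʳ-+ ((d + g) ^ suc k) d g ⟨
  (d + g) ^ suc (suc k) ∎
  where
  open ≤-Reasoning
  lemma : ∀ k d g h → suc (suc k) * (d * (g * h)) + g * (g * h) ≡ d * (g * h) + g * (suc k * (d * h) + g * h)
  lemma = solve-∀

-- Permutations

module _ {A : Set} where

  picks : List A → List (A × List A)
  picks []       = []
  picks (x ∷ xs) = (x , xs) ∷ map (map₂ (x ∷_)) (picks xs)

  picks-↭ : ∀ {p} xs → p ∈ picks xs → proj₁ p ∷ proj₂ p ↭ xs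
  picks-↭ (x ∷ xs) (here refl) = ↭-refl
  picks-↭ (x ∷ xs) (there p∈)  with _ , q∈ , refl ← ∈-map⁻ (map₂ (x ∷_)) p∈ =
    ↭-trans (swap _ _ ↭-refl) (prep x (picks-↭ xs q∈))

  picks-length : ∀ {p m} xs → length xs ≡ suc m → p ∈ picks xs → length (proj₂ p) ≡ m
  picks-length xs |xs| p∈ = suc-injective (trans (↭-length (picks-↭ xs p∈)) |xs|)

  ∑-picks : ∀ (f : A → ℕ) xs → ∑ (f ∘ proj₁) (picks xs) ≡ ∑ f xs
  ∑-picks f []       = refl
  ∑-picks f (x ∷ xs) = cong (f x +_) (trans (∑-map _ (map₂ (x ∷_)) (picks xs)) (∑-picks f xs))

  -- Two successive picks can be made in either order. The ordered pairs containing the head `z`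
  -- split into those with `z` first and those with `z` second, which the swap exchanges; the other
  -- pairs are handled by induction.
  ∑-picks-swap : ∀ (φ : A → A → List A → ℕ) xs →
    ∑ (λ (x , xs′) → ∑ (λ (y , ys) → φ x y ys) (picks xs′)) (picks xs) ≡
    ∑ (λ (x , xs′) → ∑ (λ (y , ys) → φ y x ys) (picks xs′)) (picks xs)
  ∑-picks-swap φ []       = refl
  ∑-picks-swap φ (z ∷ xs) = begin
    first φ + ∑ (λ (x , xs′) → ∑ (λ (y , ys) → φ x y ys) (picks xs′)) (map (map₂ (z ∷_)) (picks xs))
      ≡⟨ cong (first φ +_) (split φ) ⟩
    first φ + (first φ′ + rest φ)
      ≡⟨ cong (λ r → first φ + (first φ′ + r)) (∑-picks-swap (λ x y ys → φ x y (z ∷ ys)) xs) ⟩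
    first φ + (first φ′ + rest φ′)
      ≡⟨ lemma (first φ) (first φ′) (rest φ′) ⟩
    first φ′ + (first φ + rest φ′)
      ≡⟨ cong (first φ′ +_) (split φ′) ⟨
    first φ′ + ∑ (λ (x , xs′) → ∑ (λ (y , ys) → φ y x ys) (picks xs′)) (map (map₂ (z ∷_)) (picks xs))
      ∎
    where
    open ≡-Reasoning
    φ′ : A → A → List A → ℕ
    φ′ x y = φ y x
    first rest : (A → A → List A → ℕ) → ℕ
    first ψ = ∑ (λ (y , ys) → ψ z y ys) (picks xs)
    rest ψ = ∑ (λ (x , xs′) → ∑ (λ (y , ys) → ψ x y (z ∷ ys)) (picks xs′)) (picks xs)
    lemma : ∀ a b c → a + (b + c) ≡ b + (a + c)
    lemma = solve-∀
    split : ∀ ψ → ∑ (λ (x , xs′) → ∑ (λ (y , ys) → ψ x y ys) (picks xs′)) (map (map₂ (z ∷_)) (picks xs))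
                  ≡ ∑ (λ (y , ys) → ψ y z ys) (picks xs) + rest ψ
    split ψ = trans (∑-map _ (map₂ (z ∷_)) (picks xs)) (trans
      (∑-cong (λ (x , xs′) → cong (ψ x z xs′ +_) (∑-map _ (map₂ (z ∷_)) (picks xs′))) (picks xs))
      (∑-+ _ _ (picks xs)))

  -- The length is a separate argument `m` to make the recursion structural: the remainders in
  -- `picks xs` are not subterms of `xs`.
  perms : ℕ → List A → List (List A)
  perms zero    xs = [ [] ]
  perms (suc m) xs = concatMap (λ (x , ys) → map (x ∷_) (perms m ys)) (picks xs)

  perms-↭ : ∀ {m σ} xs → length xs ≡ m → σ ∈ perms m xs → σ ↭ xs
  perms-↭ {zero}  []  _    (here refl) = ↭-refl
  perms-↭ {suc m} xs |xs| σ∈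
    with (x , ys) , p∈ , σ∈ys ← find (∈-concatMap⁻ (λ (x , ys) → map (x ∷_) (perms m ys)) {xs = picks xs} σ∈)
    with τ , τ∈ , refl ← ∈-map⁻ (x ∷_) σ∈ys =
    ↭-trans (prep x (perms-↭ ys (picks-length xs |xs| p∈) τ∈)) (picks-↭ xs p∈)

  ∑-perms : ∀ (f : List A → ℕ) m xs →
            ∑ f (perms (suc m) xs) ≡ ∑ (λ (x , ys) → ∑ (λ σ → f (x ∷ σ)) (perms m ys)) (picks xs)
  ∑-perms f m xs = trans (∑-concatMap f _ (picks xs)) (∑-cong (λ (x , ys) → ∑-map f (x ∷_) (perms m ys)) (picks xs))

  ∑-perms-const : ∀ c m xs → length xs ≡ m → ∑ (λ _ → c) (perms m xs) ≡ m ! * c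
  ∑-perms-const c zero    xs |xs| = refl
  ∑-perms-const c (suc m) xs |xs| = begin
    ∑ (λ _ → c) (perms (suc m) xs)                            ≡⟨ ∑-perms (λ _ → c) m xs ⟩
    ∑ (λ (x , ys) → ∑ (λ _ → c) (perms m ys)) (picks xs)      ≡⟨ const-on-picks ⟩
    ∑ (λ _ → m ! * c) (picks xs)                              ≡⟨ ∑-picks (λ _ → m ! * c) xs ⟩
    ∑ (λ _ → m ! * c) xs                                      ≡⟨ ∑-const (m ! * c) xs ⟩
    length xs * (m ! * c)                                     ≡⟨ cong (_* (m ! * c)) |xs| ⟩
    suc m * (m ! * c)                                         ≡⟨ *-assoc (suc m) (m !) c ⟨
    suc m ! * c                                               ∎
    where
    open ≡-Reasoning
    IH : ∀ {p} → p ∈ picks xs → ∑ (λ _ → c) (perms m (proj₂ p)) ≡ m ! * c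
    IH p∈ = ∑-perms-const c m _ (picks-length xs |xs| p∈)
    const-on-picks = ≤-antisym (∑-mono (picks xs) (≤-reflexive ∘ IH)) (∑-mono (picks xs) (≤-reflexive ∘ sym ∘ IH))

  weights : List (A → ℕ) → List A → List ℕ
  weights = zipWith (λ D c → D c)

  -- The total weight of all matchings of k of the rows Ds with distinct columns from cs.
  matchings : ℕ → List (A → ℕ) → List A → ℕ
  matchings zero    Ds       cs = 1
  matchings (suc k) []       cs = 0
  matchings (suc k) (D ∷ Ds) cs =
    ∑ (λ (c , cs′) → D c * matchings k Ds cs′) (picks cs) + matchings (suc k) Ds cs

  -- A matching of `k` rows occupies `k` of the `k + j` columns, so it survives the removal of a
  -- column in `j` cases.
  ∑-picks-matchings : ∀ k j Ds cs → length cs ≡ k + j →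
    ∑ (λ (c , cs′) → matchings k Ds cs′) (picks cs) ≤ j * matchings k Ds cs
  ∑-picks-matchings zero j Ds cs |cs| = ≤-reflexive (begin
    ∑ (λ _ → 1) (picks cs) ≡⟨ ∑-picks (λ _ → 1) cs ⟩
    ∑ (λ _ → 1) cs         ≡⟨ ∑-const 1 cs ⟩
    length cs * 1          ≡⟨ cong (_* 1) |cs| ⟩
    j * 1                  ∎)
    where open ≡-Reasoning
  ∑-picks-matchings (suc k) j [] cs |cs| =
    subst (_≤ j * 0) (sym (∑-zero (picks cs))) z≤n
  ∑-picks-matchings (suc k) j (D ∷ Ds) cs |cs| = begin
    ∑ (λ (c , cs′) → ∑ (λ (d , ds) → D d * matchings k Ds ds) (picks cs′) + matchings (suc k) Ds cs′) (picks cs)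
      ≡⟨ ∑-+ _ _ (picks cs) ⟩
    ∑ (λ (c , cs′) → ∑ (λ (d , ds) → D d * matchings k Ds ds) (picks cs′)) (picks cs)
      + ∑ (λ (c , cs′) → matchings (suc k) Ds cs′) (picks cs)
      ≤⟨ +-mono-≤ first (∑-picks-matchings (suc k) j Ds cs |cs|) ⟩
    j * ∑ (λ (c , cs′) → D c * matchings k Ds cs′) (picks cs) + j * matchings (suc k) Ds cs
      ≡⟨ *-distribˡ-+ j _ _ ⟨
    j * matchings (suc k) (D ∷ Ds) cs ∎
    where
    open ≤-Reasoning
    lemma : ∀ a b c → a * (b * c) ≡ b * (a * c)
    lemma = solve-∀
    first = begin
      ∑ (λ (c , cs′) → ∑ (λ (d , ds) → D d * matchings k Ds ds) (picks cs′)) (picks cs)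
        ≡⟨ ∑-picks-swap (λ c d ds → D d * matchings k Ds ds) cs ⟩
      ∑ (λ (c , cs′) → ∑ (λ (d , ds) → D c * matchings k Ds ds) (picks cs′)) (picks cs)
        ≡⟨ ∑-cong (λ (c , cs′) → ∑-*ˡ (D c) _ (picks cs′)) (picks cs) ⟩
      ∑ (λ (c , cs′) → D c * ∑ (λ (d , ds) → matchings k Ds ds) (picks cs′)) (picks cs)
        ≤⟨ ∑-mono (picks cs) (λ {(c , cs′)} p∈ → *-monoʳ-≤ (D c) (∑-picks-matchings k j Ds cs′ (picks-length cs |cs| p∈))) ⟩
      ∑ (λ (c , cs′) → D c * (j * matchings k Ds cs′)) (picks cs)
        ≡⟨ ∑-cong (λ (c , cs′) → lemma (D c) j _) (picks cs) ⟩
      ∑ (λ (c , cs′) → j * (D c * matchings k Ds cs′)) (picks cs)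
        ≡⟨ ∑-*ˡ j _ (picks cs) ⟩
      j * ∑ (λ (c , cs′) → D c * matchings k Ds cs′) (picks cs) ∎

  length-weights : ∀ Ds σ → length (weights Ds σ) ≤ length Ds
  length-weights []       σ        = z≤n
  length-weights (D ∷ Ds) []       = z≤n
  length-weights (D ∷ Ds) (c ∷ σ) = s≤s (length-weights Ds σ)

  -- Each term of `esym k` selects `k` rows together with the columns that the permutation gives
  -- them, that is, a matching; the other `j` columns can be arranged in `j !` ways.
  ∑-esym-perms : ∀ k j Ds cs → length Ds ≡ k + j → length cs ≡ k + j →
    ∑ (esym k ∘ weights Ds) (perms (k + j) cs) ≤ j ! * matchings k Ds cs
  ∑-esym-perms zero j Ds cs _ |cs| = ≤-reflexive (∑-perms-const 1 j cs |cs|)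
  ∑-esym-perms (suc k) j (D ∷ Ds) cs |Ds| |cs| = begin
    ∑ (esym (suc k) ∘ weights (D ∷ Ds)) (perms (suc k + j) cs)
      ≡⟨ ∑-perms _ (k + j) cs ⟩
    ∑ (λ (c , cs′) → ∑ (λ σ → D c * esym k (weights Ds σ) + esym (suc k) (weights Ds σ)) (perms (k + j) cs′)) (picks cs)
      ≡⟨ ∑-cong (λ (c , cs′) → trans (∑-+ _ _ (perms (k + j) cs′)) (cong (_+ _) (∑-*ˡ (D c) _ (perms (k + j) cs′)))) (picks cs) ⟩
    ∑ (λ (c , cs′) → D c * ∑ (esym k ∘ weights Ds) (perms (k + j) cs′) + ∑ (esym (suc k) ∘ weights Ds) (perms (k + j) cs′)) (picks cs)
      ≡⟨ ∑-+ _ _ (picks cs) ⟩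
    ∑ (λ (c , cs′) → D c * ∑ (esym k ∘ weights Ds) (perms (k + j) cs′)) (picks cs)
      + ∑ (λ (c , cs′) → ∑ (esym (suc k) ∘ weights Ds) (perms (k + j) cs′)) (picks cs)
      ≤⟨ +-mono-≤ first (second j |Ds| |cs|) ⟩
    j ! * ∑ (λ (c , cs′) → D c * matchings k Ds cs′) (picks cs) + j ! * matchings (suc k) Ds cs
      ≡⟨ *-distribˡ-+ (j !) _ _ ⟨
    j ! * matchings (suc k) (D ∷ Ds) cs ∎
    where
    open ≤-Reasoning
    lemma : ∀ a b c → a * (b * c) ≡ b * (a * c)
    lemma = solve-∀
    first = begin
      ∑ (λ (c , cs′) → D c * ∑ (esym k ∘ weights Ds) (perms (k + j) cs′)) (picks cs)
        ≤⟨ ∑-mono (picks cs) (λ {(c , cs′)} p∈ → *-monoʳ-≤ (D c)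
             (∑-esym-perms k j Ds cs′ (suc-injective |Ds|) (picks-length cs |cs| p∈))) ⟩
      ∑ (λ (c , cs′) → D c * (j ! * matchings k Ds cs′)) (picks cs)
        ≡⟨ ∑-cong (λ (c , cs′) → lemma (D c) (j !) _) (picks cs) ⟩
      ∑ (λ (c , cs′) → j ! * (D c * matchings k Ds cs′)) (picks cs)
        ≡⟨ ∑-*ˡ (j !) _ (picks cs) ⟩
      j ! * ∑ (λ (c , cs′) → D c * matchings k Ds cs′) (picks cs) ∎
    second : ∀ j → suc (length Ds) ≡ suc k + j → length cs ≡ suc k + j →
      ∑ (λ (c , cs′) → ∑ (esym (suc k) ∘ weights Ds) (perms (k + j) cs′)) (picks cs) ≤ j ! * matchings (suc k) Ds cs
    -- For `j = 0` all `k + 1` rows have to be selected, but `D` is left out here.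
    second zero |Ds| |cs| = subst (_≤ 1 * matchings (suc k) Ds cs) (sym (begin-equality
      ∑ (λ (c , cs′) → ∑ (esym (suc k) ∘ weights Ds) (perms (k + 0) cs′)) (picks cs)
        ≡⟨ ∑-cong (λ (c , cs′) → trans (∑-cong too-short (perms (k + 0) cs′)) (∑-zero (perms (k + 0) cs′))) (picks cs) ⟩
      ∑ (λ _ → 0) (picks cs) ≡⟨ ∑-zero (picks cs) ⟩
      0 ∎)) z≤n
      where
      too-short : ∀ σ → esym (suc k) (weights Ds σ) ≡ 0
      too-short σ = esym-short (suc k) (weights Ds σ) (s≤s (≤-trans (length-weights Ds σ)
        (≤-reflexive (trans (suc-injective |Ds|) (+-identityʳ k)))))
    -- The column given to the unselected row `D` is one of the spare ones, so `i` spare columns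
    -- remain; summing over it restores the factor `suc i` of `suc i !`.
    second (suc i) |Ds| |cs| = begin
      ∑ (λ (c , cs′) → ∑ (esym (suc k) ∘ weights Ds) (perms (k + suc i) cs′)) (picks cs)
        ≤⟨ ∑-mono (picks cs) (λ {(c , cs′)} p∈ →
             subst (λ m → ∑ (esym (suc k) ∘ weights Ds) (perms m cs′) ≤ i ! * matchings (suc k) Ds cs′) (sym (+-suc k i))
             (∑-esym-perms (suc k) i Ds cs′ (trans (suc-injective |Ds|) (+-suc k i)) (trans (picks-length cs |cs| p∈) (+-suc k i)))) ⟩
      ∑ (λ (c , cs′) → i ! * matchings (suc k) Ds cs′) (picks cs)
        ≡⟨ ∑-*ˡ (i !) _ (picks cs) ⟩
      i ! * ∑ (λ (c , cs′) → matchings (suc k) Ds cs′) (picks cs)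
        ≤⟨ *-monoʳ-≤ (i !) (∑-picks-matchings (suc k) (suc i) Ds cs |cs|) ⟩
      i ! * (suc i * matchings (suc k) Ds cs)
        ≡⟨ rearr (i !) (suc i) (matchings (suc k) Ds cs) ⟩
      suc i ! * matchings (suc k) Ds cs ∎
      where
      rearr : ∀ a b c → a * (b * c) ≡ b * a * c
      rearr = solve-∀

  -- The power on the right expands into ordered `k`-tuples of cells, repetitions of rows and
  -- columns included, and each matching occurs there in `k !` orders. In the induction `binomial-≤`
  -- separates the tuples that use row `D` exactly once or not at all.
  matchings-≤ : ∀ k Ds cs → k ! * matchings k Ds cs ≤ ∑ (λ D → ∑ D cs) Ds ^ k
  matchings-≤ zero    Ds       cs = ≤-refl
  matchings-≤ (suc k) []       cs = ≤-reflexive (*-zeroʳ (suc k !))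
  matchings-≤ (suc k) (D ∷ Ds) cs = begin
    suc k ! * (∑ (λ (c , cs′) → D c * matchings k Ds cs′) (picks cs) + matchings (suc k) Ds cs)
      ≡⟨ *-distribˡ-+ (suc k !) _ _ ⟩
    suc k ! * ∑ (λ (c , cs′) → D c * matchings k Ds cs′) (picks cs) + suc k ! * matchings (suc k) Ds cs
      ≤⟨ +-mono-≤ (≤-trans (≤-reflexive (*-assoc (suc k) (k !) _)) (*-monoʳ-≤ (suc k) first)) (matchings-≤ (suc k) Ds cs) ⟩
    suc k * (∑ D cs * g ^ k) + g ^ suc k
      ≤⟨ binomial-≤ k (∑ D cs) g ⟩
    (∑ D cs + g) ^ suc k ∎
    where
    open ≤-Reasoning
    g = ∑ (λ D → ∑ D cs) Ds
    lemma : ∀ a b c → a * (b * c) ≡ b * (a * c)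
    lemma = solve-∀
    shrink : ∀ {p} → p ∈ picks cs → ∑ (λ D → ∑ D (proj₂ p)) Ds ≤ g
    shrink p∈ = ∑-mono Ds (λ {D} _ → ≤-trans (m≤n+m _ (D _)) (≤-reflexive (∑-↭ D (picks-↭ cs p∈))))
    first = begin
      k ! * ∑ (λ (c , cs′) → D c * matchings k Ds cs′) (picks cs)
        ≡⟨ ∑-*ˡ (k !) _ (picks cs) ⟨
      ∑ (λ (c , cs′) → k ! * (D c * matchings k Ds cs′)) (picks cs)
        ≡⟨ ∑-cong (λ (c , cs′) → lemma (k !) (D c) _) (picks cs) ⟩
      ∑ (λ (c , cs′) → D c * (k ! * matchings k Ds cs′)) (picks cs)
        ≤⟨ ∑-mono (picks cs) (λ {(c , cs′)} p∈ → *-monoʳ-≤ (D c) (≤-trans (matchings-≤ k Ds cs′) (^-monoˡ-≤ k (shrink p∈)))) ⟩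
      ∑ (λ (c , cs′) → D c * g ^ k) (picks cs)
        ≡⟨ ∑-*ʳ (g ^ k) _ (picks cs) ⟩
      ∑ (λ (c , cs′) → D c) (picks cs) * g ^ k
        ≡⟨ cong (_* g ^ k) (∑-picks D cs) ⟩
      ∑ D cs * g ^ k ∎

extract : ∀ {A : Set} {x : A} {xs} → x ∈ xs → ∃[ ys ] xs ↭ x ∷ ys
extract x∈xs with ys , zs , refl ← ∈-∃++ x∈xs = ys ++ zs , shift _ ys zs

-- Monomials as sets of variables and their values at 0/1 points

module _ {V : Set} where

  infix 4 _≐_
  -- Equality as sets of variables: exponents and order do not affect the value at a 0/1 point.
  _≐_ : List V → List V → Set
  m ≐ m′ = m ⊆ m′ × m′ ⊆ m

  ≐-refl : ∀ {m} → m ≐ m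
  ≐-refl = ⊆-refl , ⊆-refl

  ≐-sym : ∀ {m m′} → m ≐ m′ → m′ ≐ m
  ≐-sym (p , q) = q , p

  ≐-trans : ∀ {l m n} → l ≐ m → m ≐ n → l ≐ n
  ≐-trans (p , q) (p′ , q′) = ⊆-trans p p′ , ⊆-trans q′ q

  value : (V → Fin 2) → Monomial V → ℕ
  value a m = product (map (toℕ ∘ a) m)

  On : (V → Fin 2) → Monomial V → Set
  On a m = ∀ {v} → v ∈ m → a v ≡ suc zero

  value≡1 : ∀ {a} m → On a m → value a m ≡ 1
  value≡1 []      on = refl
  value≡1 (v ∷ m) on = cong₂ _*_ (cong toℕ (on (here refl))) (value≡1 m (on ∘ there))

  value≢0 : ∀ {a} m → value a m ≢ 0 → On a m
  value≢0 {a} (v ∷ m) nz (here refl) with a v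
  ... | zero     = contradiction refl nz
  ... | suc zero = refl
  value≢0 {a} (v ∷ m) nz (there v∈m) =
    value≢0 m (λ eq → nz (trans (cong (toℕ (a v) *_) eq) (*-zeroʳ (toℕ (a v))))) v∈m

  value-mono : ∀ {a m m′} → m′ ⊆ m → value a m ≤ value a m′
  value-mono {a} {m} {m′} m′⊆m with value a m ≟ᴺ 0
  ... | yes eq = subst (_≤ _) (sym eq) z≤n
  ... | no  nz = ≤-reflexive (trans (value≡1 m on) (sym (value≡1 m′ (on ∘ m′⊆m))))
    where on = value≢0 m nz

  value-cong : ∀ {a m m′} → m ≐ m′ → value a m ≡ value a m′
  value-cong (p , q) = ≤-antisym (value-mono q) (value-mono p)

  eval₀₁≢0⁻ : ∀ {a} p → eval₀₁ p a ≢ 0 → ∃[ m ] m ∈ p × On a m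
  eval₀₁≢0⁻ []      nz = contradiction refl nz
  eval₀₁≢0⁻ {a} (m ∷ p) nz with value a m ≟ᴺ 0
  ... | no  m≢0 = m , here refl , value≢0 m m≢0
  ... | yes m≡0 with m′ , m′∈p , on ← eval₀₁≢0⁻ p (λ eq → nz (cong₂ _+_ m≡0 eq)) = m′ , there m′∈p , on

  eval₀₁≢0⁺ : ∀ {a m p} → m ∈ p → On a m → eval₀₁ p a ≢ 0
  eval₀₁≢0⁺ {a} {m} {p} m∈p on = m<n⇒n≢0 {0} (subst (_≤ eval₀₁ p a) (value≡1 m on) (term≤∑ (value a) m∈p))

-- Supports determined by the values at 0/1 points

module Supports {V : Set} (_≟ᵛ_ : DecidableEquality V) where

  open DecMembership _≟ᵛ_ using (_∈?_)
  open DecSubset _≟ᵛ_ using (_⊆?_)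

  indicator : Monomial V → V → Fin 2
  indicator m v with v ∈? m
  ... | yes _ = suc zero
  ... | no  _ = zero

  indicator-on : ∀ m → On (indicator m) m
  indicator-on m {v} v∈m with v ∈? m
  ... | yes _   = refl
  ... | no  v∉m = contradiction v∈m v∉m

  On-indicator⇒⊆ : ∀ {m m′} → On (indicator m) m′ → m′ ⊆ m
  On-indicator⇒⊆ {m} on {v} v∈m′ with v ∈? m | on v∈m′
  ... | yes v∈m | _ = v∈m

  minimal : ∀ m p → ∃[ m₀ ] m₀ ∈ m ∷ p × (∀ {m′} → m′ ∈ m ∷ p → m′ ⊆ m₀ → m₀ ⊆ m′)
  minimal m [] = m , here refl , λ { (here refl) → λ _ → ⊆-refl }
  minimal m (l ∷ p) with minimal l p
  ... | m₀ , m₀∈ , least with m ⊆? m₀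
  ...   | yes m⊆m₀ = m , here refl , λ
    { (here refl)  _    → ⊆-refl
    ; (there m′∈) m′⊆m → ⊆-trans m⊆m₀ (least m′∈ (⊆-trans m′⊆m m⊆m₀)) }
  ...   | no  m⊈m₀ = m₀ , there m₀∈ , λ
    { (here refl)  m⊆m₀  → ⊥-elim (m⊈m₀ m⊆m₀)
    ; (there m′∈) m′⊆m₀ → least m′∈ m′⊆m₀ }

  infix 4 _≈₀₁_
  _≈₀₁_ : Poly V → Poly V → Set
  F ≈₀₁ G = ∀ a → eval₀₁ F a ≡ eval₀₁ G a

  -- At the indicator point of `m` the left side is nonzero, so a monomial of `G` survives there,
  -- and the survivors are those supported inside `m`.
  below : ∀ {F G m} → F ≈₀₁ G → m ∈ F → ∃[ g ] g ∈ G × g ⊆ m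
  below {F} {G} {m} F≈G m∈F
    with g , g∈G , on ← eval₀₁≢0⁻ G (λ eq → eval₀₁≢0⁺ m∈F (indicator-on m) (trans (F≈G (indicator m)) eq))
    = g , g∈G , On-indicator⇒⊆ on

  -- A monomial of minimal support on one side has to occur on the other side.
  common : ∀ F G → F ≈₀₁ G → (F ≡ [] × G ≡ []) ⊎ (∃[ m ] ∃[ g ] m ∈ F × g ∈ G × m ≐ g)
  common F G F≈G = go (F ++ G) refl
    where
    go : ∀ p → p ≡ F ++ G → (F ≡ [] × G ≡ []) ⊎ (∃[ m ] ∃[ g ] m ∈ F × g ∈ G × m ≐ g)
    go [] eq = inj₁ (++-conicalˡ F G (sym eq) , ++-conicalʳ F G (sym eq))
    go (l ∷ p) eq with m₀ , m₀∈ , least ← minimal l p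
      with ∈-++⁻ F (subst (m₀ ∈_) eq m₀∈)
    ... | inj₁ m₀∈F with g , g∈G , g⊆m₀ ← below F≈G m₀∈F =
      inj₂ (m₀ , g , m₀∈F , g∈G , least (subst (g ∈_) (sym eq) (∈-++⁺ʳ F g∈G)) g⊆m₀ , g⊆m₀)
    ... | inj₂ m₀∈G with m , m∈F , m⊆m₀ ← below (λ a → sym (F≈G a)) m₀∈G =
      inj₂ (m , m₀ , m∈F , m₀∈G , m⊆m₀ , least (subst (m ∈_) (sym eq) (∈-++⁺ˡ m∈F)) m⊆m₀)

  Matched : Poly V → Poly V → Set
  Matched F G = ∀ {m} → m ∈ F → ∃[ g ] g ∈ G × m ≐ g

  -- Here counting is essential: the two monomials found by `common` have the same value everywhere,
  -- so cancelling them preserves equality and the induction continues. Deciding the same polynomial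
  -- would only make the minimal supports agree.
  same-supports : ∀ F G → F ≈₀₁ G → Matched F G × Matched G F
  same-supports F G F≈G = go (length F) F G refl F≈G
    where
    extend : ∀ {F G F′ G′ m g} → F ↭ m ∷ F′ → G ↭ g ∷ G′ → m ≐ g → Matched F′ G′ → Matched F G
    extend F↭ G↭ m≐g match l∈F with ∈-resp-↭ F↭ l∈F
    ... | here refl = _ , ∈-resp-↭ (↭-sym G↭) (here refl) , m≐g
    ... | there l∈F′ with h , h∈G′ , l≐h ← match l∈F′ = h , ∈-resp-↭ (↭-sym G↭) (there h∈G′) , l≐h

    go : ∀ n F G → length F ≡ n → F ≈₀₁ G → Matched F G × Matched G F
    go n F G |F| F≈G with common F G F≈G
    ... | inj₁ (refl , refl) = (λ ()) , (λ ())
    ... | inj₂ (m , g , m∈F , g∈G , m≐g)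
      with F′ , F↭ ← extract m∈F | G′ , G↭ ← extract g∈G
      with n | trans (sym |F|) (↭-length F↭)
    ...   | suc n | refl
      with match , match′ ← go n F′ G′ refl (λ a → +-cancelˡ-≡ (value a m) _ _
        (trans (sym (∑-↭ (value a) F↭)) (trans (F≈G a) (trans (∑-↭ (value a) G↭)
          (cong (_+ eval₀₁ G′ a) (sym (value-cong m≐g)))))))
      = extend F↭ G↭ m≐g match , extend G↭ F↭ (≐-sym m≐g) match′

  -- Weight of a monomial along a path and its factors at a gate

  weight : Monomial V → Monomial V → ℕ
  weight p m = length (filter (_∈? m) p)

  -- The entries of `p` are counted, not those of `a` and `b`; one that lies in both factors is
  -- counted twice on the right only.
  weight-++ : ∀ p a b → weight p (a ++ b) ≤ weight p a + weight p b
  weight-++ []      a b = z≤n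
  weight-++ (e ∷ p) a b with e ∈? (a ++ b) | e ∈? a | e ∈? b
  ... | no _   | no _  | no _  = weight-++ p a b
  ... | no _   | no _  | yes _ = ≤-trans (weight-++ p a b) (+-monoʳ-≤ (weight p a) (n≤1+n _))
  ... | no _   | yes _ | no _  = m≤n⇒m≤1+n (weight-++ p a b)
  ... | no _   | yes _ | yes _ = m≤n⇒m≤1+n (≤-trans (weight-++ p a b) (+-monoʳ-≤ (weight p a) (n≤1+n _)))
  ... | yes _  | yes _ | no _  = s≤s (weight-++ p a b)
  ... | yes _  | yes _ | yes _ = s≤s (≤-trans (weight-++ p a b) (+-monoʳ-≤ (weight p a) (n≤1+n _)))
  ... | yes _  | no _  | yes _ = ≤-trans (s≤s (weight-++ p a b)) (≤-reflexive (sym (+-suc _ _)))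
  ... | yes e∈ | no e∉a | no e∉b with ∈-++⁻ a e∈
  ...   | inj₁ e∈a = contradiction e∈a e∉a
  ...   | inj₂ e∈b = contradiction e∈b e∉b

  weight-[] : ∀ p v → v ∉ p → weight p [ v ] ≡ 0
  weight-[] p v v∉p = cong length (filter-none (_∈? [ v ]) {xs = p} (tabulate λ { e∈p (here refl) → v∉p e∈p }))

  weight-var : ∀ p v → Unique p → weight p [ v ] ≤ 1
  weight-var []      v p! = z≤n
  weight-var (e ∷ p) v (e∉p ∷ p!) with e ≟ᵛ v
  ... | yes refl = s≤s (≤-reflexive (weight-[] p v (λ v∈p → lookup e∉p v∈p refl)))
  ... | no  _    = weight-var p v p!

  weight-full : ∀ {p m} → p ⊆ m → weight p m ≡ length p
  weight-full {p} p⊆m = cong length (filter-all (_∈? _) {xs = p} (tabulate p⊆m))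

  -- A decomposition of `m` along a way from `x` down to the gate `u`. The context collects the
  -- other factors met on the way and does not depend on the monomial chosen at `u`, so that
  -- `exchange` can replace `a` by anything produced there.
  record Factor {k} (gs : Gates V k) (x : Source V k) (u : Fin k) (a m : Monomial V) : Set where
    field
      context    : Monomial V
      a-produced : a ∈ producedAt gs (inj₂ u)
      factors    : m ≐ a ++ context
      exchange   : ∀ {b} → b ∈ producedAt gs (inj₂ u) → ∃[ l ] l ∈ producedAt gs x × l ≐ b ++ context

  open Factor public

  ++-cong : ∀ {a a′ b b′ : Monomial V} → a ≐ a′ → b ≐ b′ → a ++ b ≐ a′ ++ b′
  ++-cong (p , q) (p′ , q′) = ++⁺ p p′ , ++⁺ q q′

  ++-comm-≐ : ∀ (a b : Monomial V) → a ++ b ≐ b ++ a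
  ++-comm-≐ a b = ⊆-reflexive-↭ (++-comm a b) , ⊆-reflexive-↭ (++-comm b a)

  ≐-reflexive : ∀ {a b : Monomial V} → a ≡ b → a ≐ b
  ≐-reflexive refl = ≐-refl

  factor-self : ∀ {k} (gs : Gates V k) {u m} → m ∈ producedAt gs (inj₂ u) → Factor gs (inj₂ u) u m m
  factor-self gs {m = m} m∈ = record
    { context    = []
    ; a-produced = m∈
    ; factors    = ≐-reflexive (sym (++-identityʳ m))
    ; exchange   = λ {b} b∈ → b , b∈ , ≐-reflexive (sym (++-identityʳ b))
    }

  factor-suc : ∀ {k} {gs : Gates V k} {g i u a m} →
               Factor gs (inj₂ i) u a m → Factor (gs ▷ g) (inj₂ (suc i)) (suc u) a m
  factor-suc f = record { Factor f }

  module _ {k : ℕ} {gs : Gates V k} {x y : Source V k} {u : Fin k} {a m : Monomial V} where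

    factor-plusˡ : Factor gs x u a m → Factor (gs ▷ gate plus x y) (inj₂ zero) (suc u) a m
    factor-plusˡ f = record
      { context    = context f
      ; a-produced = a-produced f
      ; factors    = factors f
      ; exchange   = λ b∈ → let l , l∈ , l≐ = exchange f b∈ in l , ∈-++⁺ˡ l∈ , l≐
      }

    factor-plusʳ : Factor gs y u a m → Factor (gs ▷ gate plus x y) (inj₂ zero) (suc u) a m
    factor-plusʳ f = record
      { context    = context f
      ; a-produced = a-produced f
      ; factors    = factors f
      ; exchange   = λ b∈ → let l , l∈ , l≐ = exchange f b∈ in l , ∈-++⁺ʳ (producedAt gs x) l∈ , l≐
      }

    factor-timesˡ : ∀ {n} → n ∈ producedAt gs y → Factor gs x u a m →
                    Factor (gs ▷ gate times x y) (inj₂ zero) (suc u) a (m ++ n)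
    factor-timesˡ {n} n∈ f = record
      { context    = context f ++ n
      ; a-produced = a-produced f
      ; factors    = ≐-trans (++-cong (factors f) ≐-refl) (≐-reflexive (++-assoc a _ n))
      ; exchange   = λ {b} b∈ → let l , l∈ , l≐ = exchange f b∈ in
          l ++ n , ∈-cartesianProductWith⁺ _++_ l∈ n∈ , ≐-trans (++-cong l≐ ≐-refl) (≐-reflexive (++-assoc b _ n))
      }

    factor-timesʳ : ∀ {n} → n ∈ producedAt gs x → Factor gs y u a m →
                    Factor (gs ▷ gate times x y) (inj₂ zero) (suc u) a (n ++ m)
    factor-timesʳ {n} n∈ f = record
      { context    = context f ++ n
      ; a-produced = a-produced f
      ; factors    = move a (factors f)
      ; exchange   = λ {b} b∈ → let l , l∈ , l≐ = exchange f b∈ in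
          n ++ l , ∈-cartesianProductWith⁺ _++_ n∈ l∈ , move b l≐
      }
      where
      move : ∀ {l c} b → l ≐ b ++ c → n ++ l ≐ b ++ (c ++ n)
      move {l} {c} b l≐ = ≐-trans (++-comm-≐ n l) (≐-trans (++-cong l≐ ≐-refl) (≐-reflexive (++-assoc b c n)))

  module _ (p : Monomial V) (p! : Unique p) (κ : ℕ) (1<κ : 1 < κ) where

    Medium : ∀ {k} (gs : Gates V k) (x : Source V k) (m : Monomial V) → Set
    Medium gs x m = ∃[ u ] ∃[ a ] Factor gs x u a m × κ ≤ weight p a × weight p a ≤ 2 * κ

    -- Follow the heavier factor of each product until its weight is at most 2 κ.
    medium-factor : ∀ {k} (gs : Gates V k) x {m} → m ∈ producedAt gs x → κ ≤ weight p m → Medium gs x m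
    -- An input has weight at most 1, which is below `κ`, so the descent ends at a gate.
    medium-factor gs (inj₁ v) (here refl) κ≤ = contradiction (≤-trans κ≤ (weight-var p v p!)) (<⇒≱ 1<κ)
    medium-factor (gs ▷ g) (inj₂ (suc i)) m∈ κ≤
      with u , a , f , bounds ← medium-factor gs (inj₂ i) m∈ κ≤ = suc u , a , factor-suc f , bounds
    medium-factor (gs ▷ gate plus x y) (inj₂ zero) m∈ κ≤ with ∈-++⁻ (producedAt gs x) m∈
    ... | inj₁ m∈x with u , a , f , bounds ← medium-factor gs x m∈x κ≤ = suc u , a , factor-plusˡ f , bounds
    ... | inj₂ m∈y with u , a , f , bounds ← medium-factor gs y m∈y κ≤ = suc u , a , factor-plusʳ f , bounds
    medium-factor gs′@(gs ▷ gate times x y) (inj₂ zero) {m} m∈ κ≤ with weight p m ≤? 2 * κ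
    ... | yes ≤2κ = zero , m , factor-self gs′ m∈ , κ≤ , ≤2κ
    ... | no  ≰2κ
      with b , c , b∈x , c∈y , refl ← ∈-cartesianProductWith⁻ _++_ (producedAt gs x) (producedAt gs y) m∈
      with κ ≤? weight p b | κ ≤? weight p c
    ...   | yes κ≤b | _
      with u , a , f , bounds ← medium-factor gs x b∈x κ≤b = suc u , a , factor-timesˡ c∈y f , bounds
    ...   | no  _   | yes κ≤c
      with u , a , f , bounds ← medium-factor gs y c∈y κ≤c = suc u , a , factor-timesʳ b∈x f , bounds
    -- Two factors lighter than `κ` cannot have a product heavier than `2 * κ`.
    ...   | no  κ≰b | no  κ≰c = contradiction
      (≤-trans (weight-++ p b c) (≤-trans (+-mono-≤ (≰⇒≥ κ≰b) (≰⇒≥ κ≰c)) (≤-reflexive (cong (κ +_) (sym (+-identityʳ κ)))))) ≰2κ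

∑-⊆ : ∀ {A : Set} (f : A → ℕ) {xs ys} → Unique xs → (∀ {x} → x ∈ xs → f x ≢ 0 → x ∈ ys) → ∑ f xs ≤ ∑ f ys
∑-⊆ f {[]}     {ys} []            sub = z≤n
∑-⊆ f {x ∷ xs} {ys} (x∉xs ∷ xs!) sub with f x ≤? 0
... | yes fx≤0 = ≤-trans (+-monoˡ-≤ _ fx≤0) (∑-⊆ f xs! (sub ∘ there))
... | no  fx≰0 with ys′ , ys↭ ← extract (sub (here refl) (λ eq → fx≰0 (≤-reflexive eq))) =
  subst (f x + ∑ f xs ≤_) (sym (∑-↭ f ys↭)) (+-monoʳ-≤ (f x) (∑-⊆ f xs! λ y∈xs fy≢0 →
    drop-head (lookup x∉xs y∈xs) (∈-resp-↭ ys↭ (sub (there y∈xs) fy≢0))))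
  where
  drop-head : ∀ {y} → x ≢ y → y ∈ x ∷ ys′ → y ∈ ys′
  drop-head x≢y (here y≡x)  = contradiction (sym y≡x) x≢y
  drop-head x≢y (there y∈)  = y∈

-- Edges, vertex degrees and paths

infix 4 _≟ᴱ_
_≟ᴱ_ : ∀ {m} → DecidableEquality (Edge m)
edge u v _ ≟ᴱ edge u′ v′ _ with u ≟ u′ | v ≟ v′
... | yes refl | yes refl = yes refl
... | no  u≢u′ | _        = no λ { refl → u≢u′ refl }
... | _        | no  v≢v′ = no λ { refl → v≢v′ refl }

module _ {m : ℕ} where

  δ : Fin m → Fin m → ℕ
  δ u v with u ≟ v
  ... | yes _ = 1
  ... | no  _ = 0

  δ-refl : ∀ u → δ u u ≡ 1
  δ-refl u with u ≟ u
  ... | yes _   = refl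
  ... | no  u≢u = contradiction refl u≢u

  δ-≢ : ∀ {u v} → u ≢ v → δ u v ≡ 0
  δ-≢ {u} {v} u≢v with u ≟ v
  ... | yes u≡v = contradiction u≡v u≢v
  ... | no  _   = refl

  δ-sym : ∀ u v → δ u v ≡ δ v u
  δ-sym u v with u ≟ v
  ... | yes refl = sym (δ-refl u)
  ... | no  u≢v  = sym (δ-≢ (u≢v ∘ sym))

  occurrences : Fin m → List (Fin m) → ℕ
  occurrences w = ∑ (δ w)

  occurrences-∉ : ∀ {w} vs → w ∉ vs → occurrences w vs ≡ 0
  occurrences-∉ []       w∉ = refl
  occurrences-∉ (v ∷ vs) w∉ = cong₂ _+_ (δ-≢ (w∉ ∘ here)) (occurrences-∉ vs (w∉ ∘ there))

  occurrences-∈ : ∀ {w vs} → w ∈ vs → 1 ≤ occurrences w vs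
  occurrences-∈ {w} {vs} w∈vs = subst (_≤ occurrences w vs) (δ-refl w) (term≤∑ (δ w) w∈vs)

  occurrences-! : ∀ w {vs} → Unique vs → occurrences w vs ≤ 1
  occurrences-! w []                     = z≤n
  occurrences-! w {v ∷ vs} (v∉vs ∷ vs!) with w ≟ v
  ... | yes refl = ≤-reflexive (cong suc (occurrences-∉ vs (λ v∈ → lookup v∉vs v∈ refl)))
  ... | no  _    = occurrences-! w vs!

  ∑-δ : ∀ {vs} → Unique vs → ∀ w → ∑ (λ v → δ v w) vs ≤ 1
  ∑-δ {vs} vs! w = subst (_≤ 1) (∑-cong (δ-sym w) vs) (occurrences-! w vs!)

  incidence : Fin m → Edge m → ℕ
  incidence w e = δ w (Edge.lo e) + δ w (Edge.hi e)

  joins : Fin m → Fin m → Edge m → ℕ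
  joins u v e = δ u (Edge.lo e) * δ v (Edge.hi e) + δ v (Edge.lo e) * δ u (Edge.hi e)

  joins-sym : ∀ u v e → joins u v e ≡ joins v u e
  joins-sym u v e = +-comm (δ u (Edge.lo e) * δ v (Edge.hi e)) _

  degree : Fin m → Monomial (Edge m) → ℕ
  degree w = ∑ (incidence w)

  module _ {u v : Fin m} (u≢v : u ≢ v) where

    incidence-— : ∀ w → incidence w [ u — v ]⟨ u≢v ⟩ ≡ δ w u + δ w v
    incidence-— w with <-cmp u v
    ... | tri< _ _   _ = refl
    ... | tri≈ _ u≡v _ = contradiction u≡v u≢v
    ... | tri> _ _   _ = +-comm (δ w v) (δ w u)

    incidence-—ˡ : 1 ≤ incidence u [ u — v ]⟨ u≢v ⟩
    incidence-—ˡ = subst (1 ≤_) (sym (trans (incidence-— u) (cong (_+ δ u v) (δ-refl u)))) (s≤s z≤n)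

    incidence-—ʳ : 1 ≤ incidence v [ u — v ]⟨ u≢v ⟩
    incidence-—ʳ = subst (1 ≤_) (sym (trans (incidence-— v) (cong (δ v u +_) (δ-refl v)))) (m≤n+m 1 (δ v u))

    joins-— : 1 ≤ joins u v [ u — v ]⟨ u≢v ⟩
    joins-— with <-cmp u v
    ... | tri< _ _   _ = subst (1 ≤_) (cong (_+ δ v u * δ u v) (sym (cong₂ _*_ (δ-refl u) (δ-refl v)))) (s≤s z≤n)
    ... | tri≈ _ u≡v _ = contradiction u≡v u≢v
    ... | tri> _ _   _ = subst (1 ≤_) (cong (δ u v * δ v u +_) (sym (cong₂ _*_ (δ-refl v) (δ-refl u)))) (m≤n+m 1 _)

  -- Only the missing edge at the start `u` is compensated, while the slack at the other end is
  -- given away. The bound serves to show that a vertex off the path has degree 0.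
  degree-start : ∀ w u vs (p : Unique (u ∷ vs)) →
                 degree w (pathMonomial (u ∷ vs) p) + δ w u ≤ 2 * occurrences w (u ∷ vs)
  degree-start w u []       _                 = ≤-trans (m≤m+n (δ w u) 0) (m≤m+n (δ w u + 0) _)
  degree-start w u (v ∷ vs) ((u≢v ∷ _) ∷ vs!) = begin
    incidence w [ u — v ]⟨ u≢v ⟩ + d + δ w u
      ≡⟨ cong (λ i → i + d + δ w u) (incidence-— u≢v w) ⟩
    δ w u + δ w v + d + δ w u
      ≡⟨ lemma (δ w u) (δ w v) d ⟩
    2 * δ w u + (d + δ w v)
      ≤⟨ +-monoʳ-≤ (2 * δ w u) (degree-start w v vs vs!) ⟩
    2 * δ w u + 2 * occurrences w (v ∷ vs)
      ≡⟨ *-distribˡ-+ 2 (δ w u) _ ⟨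
    2 * occurrences w (u ∷ v ∷ vs) ∎
    where
    open ≤-Reasoning
    d = degree w (pathMonomial (v ∷ vs) vs!)
    lemma : ∀ a b c → a + b + c + a ≡ 2 * a + (c + b)
    lemma = solve-∀

  -- The ends `u` and `z` have degree 1 where inner vertices have degree 2; the added `δ` terms
  -- supply the missing units.
  degree-path : ∀ w u vs z (p : Unique (u ∷ vs ++ [ z ])) →
    degree w (pathMonomial (u ∷ vs ++ [ z ]) p) + (δ w u + δ w z) ≡ 2 * occurrences w (u ∷ vs ++ [ z ])
  degree-path w u [] z ((u≢z ∷ _) ∷ _) = trans
    (cong (λ i → i + 0 + (δ w u + δ w z)) (incidence-— u≢z w)) (lemma (δ w u) (δ w z))
    where
    lemma : ∀ a b → a + b + 0 + (a + b) ≡ 2 * (a + (b + 0))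
    lemma = solve-∀
  degree-path w u (v ∷ vs) z ((u≢v ∷ _) ∷ vs!) = begin
    incidence w [ u — v ]⟨ u≢v ⟩ + d + (δ w u + δ w z)
      ≡⟨ cong (λ i → i + d + (δ w u + δ w z)) (incidence-— u≢v w) ⟩
    δ w u + δ w v + d + (δ w u + δ w z)
      ≡⟨ lemma (δ w u) (δ w v) (δ w z) d ⟩
    2 * δ w u + (d + (δ w v + δ w z))
      ≡⟨ cong (2 * δ w u +_) (degree-path w v vs z vs!) ⟩
    2 * δ w u + 2 * occurrences w (v ∷ vs ++ [ z ])
      ≡⟨ *-distribˡ-+ 2 (δ w u) _ ⟨
    2 * occurrences w (u ∷ v ∷ vs ++ [ z ]) ∎
    where
    open ≡-Reasoning
    d = degree w (pathMonomial (v ∷ vs ++ [ z ]) vs!)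
    lemma : ∀ a b c d → a + b + d + (a + c) ≡ 2 * a + (d + (b + c))
    lemma = solve-∀

  -- The first edge meets `u`, whereas the rest of the path avoids `u` and so has degree 0 there.
  pathMonomial-! : ∀ vs (p : Unique vs) → Unique (pathMonomial vs p)
  pathMonomial-! []           _                          = []
  pathMonomial-! (u ∷ [])     _                          = []
  pathMonomial-! (u ∷ v ∷ vs) (u∉@(u≢v ∷ _) ∷ vs!) =
    tabulate (λ e∈ u—v≡e → <⇒≱ (incidence-—ˡ u≢v) (≤-trans
      (≤-trans (≤-reflexive (cong (incidence u) u—v≡e)) (term≤∑ (incidence u) e∈))
      (≤-trans (m≤m+n (degree u (pathMonomial (v ∷ vs) vs!)) (δ u v)) (≤-trans (degree-start u v vs vs!)
        (≤-reflexive (cong (2 *_) (occurrences-∉ (v ∷ vs) (λ u∈ → lookup u∉ u∈ refl))))))))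
    ∷ pathMonomial-! (v ∷ vs) vs!

  length-pathMonomial : ∀ (u : Fin m) vs (p : Unique (u ∷ vs)) → length (pathMonomial (u ∷ vs) p) ≡ length vs
  length-pathMonomial u []       _                 = refl
  length-pathMonomial u (v ∷ vs) ((u≢v ∷ _) ∷ vs!) = cong suc (length-pathMonomial v vs vs!)

  -- Two paths with the same ends have the same degree at each common vertex.
  no-extra-edge : ∀ {w e u z vs ws} (p : Unique (u ∷ vs ++ [ z ])) (q : Unique (u ∷ ws ++ [ z ])) →
    w ∈ u ∷ vs ++ [ z ] → 1 ≤ incidence w e →
    e ∉ pathMonomial (u ∷ vs ++ [ z ]) p → e ∈ pathMonomial (u ∷ ws ++ [ z ]) q →
    (∀ {e′} → e′ ∈ pathMonomial (u ∷ vs ++ [ z ]) p → incidence w e′ ≢ 0 → e′ ∈ pathMonomial (u ∷ ws ++ [ z ]) q) →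
    ⊥
  no-extra-edge {w} {e} {u} {z} {vs} {ws} p q w∈ w∈e e∉P e∈Q sub = 1+n≰n (begin
    suc (degree w P + d)                ≤⟨ +-monoˡ-≤ (degree w P + d) w∈e ⟩
    incidence w e + (degree w P + d)    ≡⟨ +-assoc (incidence w e) (degree w P) d ⟨
    degree w (e ∷ P) + d                ≤⟨ +-monoˡ-≤ d (∑-⊆ (incidence w) e∷P! sub′) ⟩
    degree w Q + d                      ≡⟨ degree-path w u ws z q ⟩
    2 * occurrences w (u ∷ ws ++ [ z ]) ≤⟨ *-monoʳ-≤ 2 (occurrences-! w q) ⟩
    2 * 1                               ≤⟨ *-monoʳ-≤ 2 (occurrences-∈ w∈) ⟩
    2 * occurrences w (u ∷ vs ++ [ z ]) ≡⟨ degree-path w u vs z p ⟨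
    degree w P + d                      ∎)
    where
    open ≤-Reasoning
    P = pathMonomial (u ∷ vs ++ [ z ]) p
    Q = pathMonomial (u ∷ ws ++ [ z ]) q
    d = δ w u + δ w z
    e∷P! : Unique (e ∷ P)
    e∷P! = tabulate (λ e′∈P e≡e′ → e∉P (subst (_∈ P) (sym e≡e′) e′∈P)) ∷ pathMonomial-! _ p
    sub′ : ∀ {e′} → e′ ∈ e ∷ P → incidence w e′ ≢ 0 → e′ ∈ Q
    sub′ (here refl)   _  = e∈Q
    sub′ (there e′∈P) nz = sub e′∈P nz

  -- Each of the two orientations of `e` names one row and one column, and these occur at most once
  -- in the lists.
  ∑∑-joins : ∀ {rs cs} → Unique rs → Unique cs → ∀ e → ∑ (λ r → ∑ (λ c → joins r c e) cs) rs ≤ 2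
  ∑∑-joins {rs} {cs} rs! cs! e = begin
    ∑ (λ r → ∑ (λ c → δ r lo * δ c hi + δ c lo * δ r hi) cs) rs
      ≡⟨ ∑-cong (λ r → trans (∑-+ _ _ cs) (cong₂ _+_ (∑-*ˡ (δ r lo) _ cs) (trans (∑-*ʳ (δ r hi) _ cs) (*-comm _ (δ r hi))))) rs ⟩
    ∑ (λ r → δ r lo * ∑ (λ c → δ c hi) cs + δ r hi * ∑ (λ c → δ c lo) cs) rs
      ≡⟨ trans (∑-+ _ _ rs) (cong₂ _+_ (∑-*ʳ (∑ (λ c → δ c hi) cs) _ rs) (∑-*ʳ (∑ (λ c → δ c lo) cs) _ rs)) ⟩
    ∑ (λ r → δ r lo) rs * ∑ (λ c → δ c hi) cs + ∑ (λ r → δ r hi) rs * ∑ (λ c → δ c lo) cs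
      ≤⟨ +-mono-≤ (*-mono-≤ (∑-δ rs! lo) (∑-δ cs! hi)) (*-mono-≤ (∑-δ rs! hi) (∑-δ cs! lo)) ⟩
    2 ∎
    where
    open ≤-Reasoning
    open Edge e using (lo; hi)

  -- Double counting: an edge contributes to the degrees of its two ends only.
  ∑-degree : ∀ {vs} → Unique vs → ∀ es → ∑ (λ v → degree v es) vs ≤ 2 * length es
  ∑-degree {vs} vs! es = begin
    ∑ (λ v → degree v es) vs
      ≡⟨ ∑-swap incidence vs es ⟩
    ∑ (λ e → ∑ (λ v → incidence v e) vs) es
      ≤⟨ ∑-bounded 2 es (λ e → ≤-trans (≤-reflexive (∑-+ _ _ vs)) (+-mono-≤ (∑-δ vs! (Edge.lo e)) (∑-δ vs! (Edge.hi e)))) ⟩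
    length es * 2
      ≡⟨ *-comm (length es) 2 ⟩
    2 * length es ∎
    where open ≤-Reasoning

  -- Only positivity matters; as a number it needs no decision and adds up under ∑.
  suspect : (P T : Monomial (Edge m)) → Fin m → Fin m → ℕ
  suspect P T u v = ∑ (joins u v) P + degree u T * degree v T

  suspect-sym : ∀ P T u v → suspect P T u v ≡ suspect P T v u
  suspect-sym P T u v = cong₂ _+_ (∑-cong (joins-sym u v) P) (*-comm (degree u T) _)

  -- Each edge of `P` joins at most two pairs. The product of degrees factors into a sum over rows
  -- times a sum over columns, both bounded by the number of ends of edges of `T`.
  ∑∑-suspect : ∀ P T {rs cs} → Unique rs → Unique cs →
    ∑ (λ r → ∑ (suspect P T r) cs) rs ≤ 2 * length P + (2 * length T) * (2 * length T)
  ∑∑-suspect P T {rs} {cs} rs! cs! = begin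
    ∑ (λ r → ∑ (suspect P T r) cs) rs
      ≡⟨ ∑-cong (λ r → trans (∑-+ _ _ cs) (cong₂ _+_ (∑-swap (joins r) cs P) (∑-*ˡ (degree r T) _ cs))) rs ⟩
    ∑ (λ r → ∑ (λ e → ∑ (λ c → joins r c e) cs) P + degree r T * ∑ (λ c → degree c T) cs) rs
      ≡⟨ trans (∑-+ _ _ rs) (cong₂ _+_ (∑-swap (λ r e → ∑ (λ c → joins r c e) cs) rs P) (∑-*ʳ (∑ (λ c → degree c T) cs) _ rs)) ⟩
    ∑ (λ e → ∑ (λ r → ∑ (λ c → joins r c e) cs) rs) P + ∑ (λ r → degree r T) rs * ∑ (λ c → degree c T) cs
      ≤⟨ +-mono-≤ (≤-trans (∑-bounded 2 P (∑∑-joins rs! cs!)) (≤-reflexive (*-comm (length P) 2)))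
                  (*-mono-≤ (∑-degree rs! T) (∑-degree cs! T)) ⟩
    2 * length P + (2 * length T) * (2 * length T) ∎
    where open ≤-Reasoning

-- The path polynomial

module _ {A : Set} where

  ∈-words : ∀ {as : List A} w → w ⊆ as → w ∈ words as (length w)
  ∈-words []      w⊆as = here refl
  ∈-words (a ∷ w) w⊆as = ∈-cartesianProductWith⁺ _∷_ (w⊆as (here refl)) (∈-words w (w⊆as ∘ there))

∈-pathPoly⁻ : ∀ {m g} (vs : List (Fin m)) → g ∈ pathPoly vs → ∃[ p ] g ≡ pathMonomial vs p
∈-pathPoly⁻ vs g∈ with unique? _≟_ vs
∈-pathPoly⁻ vs (here g≡) | yes vs! = vs! , g≡

∈-pathPoly⁺ : ∀ {m} (vs : List (Fin m)) → Unique vs → ∃[ p ] pathMonomial vs p ∈ pathPoly vs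
∈-pathPoly⁺ vs vs! with unique? _≟_ vs
... | yes p  = p , here refl
... | no ¬p  = contradiction vs! ¬p

module _ {n : ℕ} where

  route : List (Fin n) → List (Fin (2 + n))
  route is = s ∷ map inner is ++ [ t ]

  ∈-Path⁻ : ∀ {g} → g ∈ Path n → ∃[ is ] ∃[ p ] g ≡ pathMonomial (route is) p
  ∈-Path⁻ g∈
    with l  , _ , g∈l  ← find (∈-concatMap⁻ (λ l → concatMap (λ is → pathPoly (route is)) (words (allFin n) l)) {xs = upTo (suc n)} g∈)
    with is , _ , g∈is ← find (∈-concatMap⁻ (λ is → pathPoly (route is)) {xs = words (allFin n) l} g∈l)
    = is , ∈-pathPoly⁻ (route is) g∈is

  ∈-Path⁺ : ∀ is → length is ≤ n → Unique (route is) → ∃[ p ] pathMonomial (route is) p ∈ Path n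
  ∈-Path⁺ is |is|≤n is! with p , m∈ ← ∈-pathPoly⁺ (route is) is! =
    p , ∈-concatMap⁺ (λ l → concatMap (λ is → pathPoly (route is)) (words (allFin n) l))
          (lose (∈-upTo⁺ (s≤s |is|≤n)) (∈-concatMap⁺ (λ is → pathPoly (route is))
            (lose (∈-words is (λ {i} _ → ∈-allFin i)) m∈)))

-- Paths alternating between a permutation of the columns and the fixed rows

module _ {A : Set} where

  interleave : List A → List A → List A
  interleave (c ∷ cs) (r ∷ rs) = c ∷ r ∷ interleave cs rs
  interleave _        _        = []

  interleave-↭ : ∀ cs rs → length cs ≡ length rs → interleave cs rs ↭ cs ++ rs
  interleave-↭ []       []       _  = ↭-refl
  interleave-↭ (c ∷ cs) (r ∷ rs) eq = prep c (↭-trans (prep r (interleave-↭ cs rs (suc-injective eq))) (↭-sym (shift r cs rs)))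

module _ {n : ℕ} where

  open Supports (_≟ᴱ_ {2 + n})
  open DecMembership (_≟ᴱ_ {2 + n}) using (_∈?_)

  module _ (P T : Monomial (Edge (2 + n))) where

    -- On a zigzag path the column placed at row `r` lies between `u`, which is `s` or the preceding
    -- row, and `r`. Both of its edges are attributed to the cell of `r` and this column.
    suspects : Fin (2 + n) → List (Fin n) → List (Fin n → ℕ)
    suspects u []       = []
    suspects u (r ∷ rs) = (λ c → suspect P T u (inner c) + suspect P T (inner r) (inner c)) ∷ suspects (inner r) rs

    length-suspects : ∀ u rs → length (suspects u rs) ≡ length rs
    length-suspects u []       = refl
    length-suspects u (r ∷ rs) = cong suc (length-suspects (inner r) rs)

    -- A row is next to two columns, the one before it and the one after it, hence the factor 2.
    ∑-suspects : ∀ u rs cs → ∑ (λ D → ∑ D cs) (suspects u rs) ≤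
      2 * ∑ (λ r → ∑ (suspect P T r) (map inner cs)) (u ∷ map inner rs)
    ∑-suspects u rs cs = ≤-trans (go u rs) (≤-trans
        (+-monoˡ-≤ (2 * ∑ (B ∘ inner) rs) (m≤m+n (B u) _))
        (≤-reflexive (trans (sym (*-distribˡ-+ 2 (B u) _)) (cong (λ b → 2 * (B u + b)) (sym (∑-map B inner rs))))))
      where
      open ≤-Reasoning
      B : Fin (2 + n) → ℕ
      B v = ∑ (suspect P T v) (map inner cs)
      lemma : ∀ a b c → a + b + (b + 2 * c) ≡ a + 2 * (b + c)
      lemma = solve-∀
      go : ∀ u rs → ∑ (λ D → ∑ D cs) (suspects u rs) ≤ B u + 2 * ∑ (B ∘ inner) rs
      go u []       = z≤n
      go u (r ∷ rs) = begin
        ∑ (λ c → suspect P T u (inner c) + suspect P T (inner r) (inner c)) cs + ∑ (λ D → ∑ D cs) (suspects (inner r) rs)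
          ≤⟨ +-monoʳ-≤ _ (go (inner r) rs) ⟩
        ∑ (λ c → suspect P T u (inner c) + suspect P T (inner r) (inner c)) cs + (B (inner r) + 2 * ∑ (B ∘ inner) rs)
          ≡⟨ cong (_+ _) (trans (∑-+ _ _ cs) (sym (cong₂ _+_ (∑-map _ inner cs) (∑-map _ inner cs)))) ⟩
        B u + B (inner r) + (B (inner r) + 2 * ∑ (B ∘ inner) rs)
          ≡⟨ lemma (B u) (B (inner r)) _ ⟩
        B u + 2 * (B (inner r) + ∑ (B ∘ inner) rs) ∎

    weight-∷-≤ : ∀ e p (a : Monomial (Edge (2 + n))) → weight (e ∷ p) a ≤ suc (weight p a)
    weight-∷-≤ e p a with e ∈? a
    ... | yes _ = ≤-refl
    ... | no  _ = n≤1+n _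

    weight-∷-∉ : ∀ {e} p (a : Monomial (Edge (2 + n))) → e ∉ a → weight (e ∷ p) a ≡ weight p a
    weight-∷-∉ {e} p a e∉a with e ∈? a
    ... | yes e∈a = contradiction e∈a e∉a
    ... | no  _   = refl

    -- By `H`, a cell of weight 0 has neither of its two edges in `a`, so each counted cell accounts
    -- for at most two edges. The last edge, into `t`, belongs to no cell and gives the `+ 1`.
    weight-≤-support : ∀ (a : Monomial (Edge (2 + n))) u cs rs
      (p : Unique (u ∷ map inner (interleave cs rs) ++ [ t ])) →
      (∀ {v w} (v≢w : v ≢ w) → v ∈ u ∷ map inner (interleave cs rs) ++ [ t ] →
        w ∈ u ∷ map inner (interleave cs rs) ++ [ t ] → [ v — w ]⟨ v≢w ⟩ ∈ a → 1 ≤ suspect P T v w) →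
      weight (pathMonomial (u ∷ map inner (interleave cs rs) ++ [ t ]) p) a ≤ 2 * support (weights (suspects u rs) cs) + 1
    weight-≤-support a u []       []       ((u≢t ∷ _) ∷ _) H = weight-∷-≤ [ u — t ]⟨ u≢t ⟩ [] a
    weight-≤-support a u []       (r ∷ rs) ((u≢t ∷ _) ∷ _) H = weight-∷-≤ [ u — t ]⟨ u≢t ⟩ [] a
    weight-≤-support a u (c ∷ cs) []       ((u≢t ∷ _) ∷ _) H = weight-∷-≤ [ u — t ]⟨ u≢t ⟩ [] a
    weight-≤-support a u (c ∷ cs) (r ∷ rs) ((u≢c ∷ _) ∷ ((c≢r ∷ _) ∷ p)) H = step (D ≟ᴺ 0)
      where
      open ≤-Reasoning
      IH : weight (pathMonomial (inner r ∷ map inner (interleave cs rs) ++ [ t ]) p) a ≤ 2 * support (weights (suspects (inner r) rs) cs) + 1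
      IH = weight-≤-support a (inner r) cs rs p (λ q v∈ w∈ → H q (there (there v∈)) (there (there w∈)))
      D = suspect P T u (inner c) + suspect P T (inner r) (inner c)
      e = [ u — inner c ]⟨ u≢c ⟩
      f = [ inner c — inner r ]⟨ c≢r ⟩
      M = pathMonomial (inner r ∷ map inner (interleave cs rs) ++ [ t ]) p
      S = support (weights (suspects (inner r) rs) cs)
      lemma : ∀ S → 2 + (2 * S + 1) ≡ 2 * (1 + S) + 1
      lemma = solve-∀
      step : Dec (D ≡ 0) → weight (e ∷ f ∷ M) a ≤ 2 * (1 ⊓ D + S) + 1
      step (yes D≡0) = begin
        weight (e ∷ f ∷ M) a    ≡⟨ weight-∷-∉ (f ∷ M) a e∉a ⟩
        weight (f ∷ M) a        ≡⟨ weight-∷-∉ M a f∉a ⟩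
        weight M a              ≤⟨ IH ⟩
        2 * S + 1               ≤⟨ +-monoˡ-≤ 1 (*-monoʳ-≤ 2 (m≤n+m S (1 ⊓ D))) ⟩
        2 * (1 ⊓ D + S) + 1     ∎
        where
        e∉a : e ∉ a
        e∉a e∈a = <⇒≱ (H u≢c (here refl) (there (here refl)) e∈a) (≤-trans (m≤m+n (suspect P T u (inner c)) _) (≤-reflexive D≡0))
        f∉a : f ∉ a
        f∉a f∈a = <⇒≱ (H c≢r (there (here refl)) (there (there (here refl))) f∈a)
          (≤-trans (≤-reflexive (suspect-sym P T (inner c) (inner r))) (≤-trans (m≤n+m _ (suspect P T u (inner c))) (≤-reflexive D≡0)))
      step (no D≢0) = begin
        weight (e ∷ f ∷ M) a    ≤⟨ weight-∷-≤ e (f ∷ M) a ⟩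
        1 + weight (f ∷ M) a    ≤⟨ s≤s (weight-∷-≤ f M a) ⟩
        2 + weight M a          ≤⟨ +-monoʳ-≤ 2 IH ⟩
        2 + (2 * S + 1)         ≡⟨ lemma S ⟩
        2 * (1 + S) + 1         ≡⟨ cong (λ d → 2 * (d + S) + 1) (sym (m≤n⇒m⊓n≡m (n≢0⇒n>0 D≢0))) ⟩
        2 * (1 ⊓ D + S) + 1     ∎

  -- An edge of `P` is suspect by its `joins` term. For any other edge, both ends must meet edges of
  -- `P` from `a₀`: otherwise all edges of `P` at such an end lie in the context `c` and stay on the
  -- exchanged path, where `no-extra-edge` leaves no room for a further edge.
  exchanged-edge : ∀ {xs ws} (p : Unique (route xs)) (q : Unique (route ws)) (a₀ a c : Monomial (Edge (2 + n))) →
    pathMonomial (route xs) p ≐ a₀ ++ c → pathMonomial (route ws) q ≐ a ++ c →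
    ∀ {u v} (u≢v : u ≢ v) → u ∈ route xs → v ∈ route xs → [ u — v ]⟨ u≢v ⟩ ∈ a →
    1 ≤ suspect (pathMonomial (route xs) p) (filter (_∈? a₀) (pathMonomial (route xs) p)) u v
  exchanged-edge {xs} {ws} p q a₀ a c P≐ Q≐ {u} {v} u≢v u∈ v∈ e∈a with [ u — v ]⟨ u≢v ⟩ ∈? pathMonomial (route xs) p
  ... | yes e∈P = ≤-trans (joins-— u≢v) (≤-trans (term≤∑ (joins u v) e∈P) (m≤m+n _ _))
  ... | no  e∉P = ≤-trans (*-mono-≤ (touched u∈ (incidence-—ˡ u≢v)) (touched v∈ (incidence-—ʳ u≢v)))
                    (m≤n+m _ (∑ (joins u v) P))
    where
    P = pathMonomial (route xs) p
    T = filter (_∈? a₀) P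
    e = [ u — v ]⟨ u≢v ⟩
    touched : ∀ {w} → w ∈ route xs → 1 ≤ incidence w e → 1 ≤ degree w T
    touched {w} w∈ w∈e with degree w T ≟ᴺ 0
    ... | no  nz = n≢0⇒n>0 nz
    ... | yes d≡0 = ⊥-elim (no-extra-edge p q w∈ w∈e e∉P (proj₂ Q≐ (∈-++⁺ˡ e∈a)) in-Q)
      where
      in-Q : ∀ {e′} → e′ ∈ P → incidence w e′ ≢ 0 → e′ ∈ pathMonomial (route ws) q
      in-Q {e′} e′∈P nz with ∈-++⁻ a₀ (proj₁ P≐ e′∈P)
      ... | inj₂ e′∈c = proj₂ Q≐ (∈-++⁺ʳ a e′∈c)
      ... | inj₁ e′∈a₀ = contradiction
        (n≤0⇒n≡0 (subst (incidence w e′ ≤_) d≡0 (term≤∑ (incidence w) (∈-filter⁺ (_∈? a₀) e′∈P e′∈a₀)))) nz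

-- A weighted pigeonhole principle

module _ {A : Set} where

  Unique-resp-↭ : ∀ {xs ys : List A} → xs ↭ ys → Unique xs → Unique ys
  Unique-resp-↭ xs↭ys = SetoidPermutation.Unique-resp-↭ (setoid A) (↭⇒↭ₛ xs↭ys)

  separate : ∀ {K} (P : Fin (suc K) → A → Set) {xs} → All (λ x → ∃[ u ] P u x) xs →
    ∃[ ys ] ∃[ zs ] xs ↭ ys ++ zs × All (P zero) ys × All (λ x → ∃[ u ] P (suc u) x) zs
  separate P [] = [] , [] , ↭-refl , [] , []
  separate P (_∷_ {x} pu pxs) with separate P pxs
  separate P (_∷_ {x} (zero  , p) pxs) | ys , zs , ↭yz , pys , pzs = x ∷ ys , zs , prep x ↭yz , p ∷ pys , pzs
  separate P (_∷_ {x} (suc u , p) pxs) | ys , zs , ↭yz , pys , pzs =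
    ys , x ∷ zs , ↭-trans (prep x ↭yz) (↭-sym (shift x ys zs)) , pys , (u , p) ∷ pzs

  -- The function `f` dominates the indicator of the fibre over `u` and may be constructed from any
  -- single member `x` of that fibre. The bound on a fibre is the quotient of `B` by `b`, written
  -- without division.
  pigeonhole : ∀ {b B} K (P : Fin K → A → Set) {xs} → All (λ x → ∃[ u ] P u x) xs →
    (∀ {u x} → P u x → ∃[ f ] (∀ {y} → P u y → 1 ≤ f y) × ∑ f xs * b ≤ B) →
    length xs * b ≤ K * B
  pigeonhole zero    P []              fibre = z≤n
  pigeonhole zero    P ((() , _) ∷ _) fibre
  pigeonhole {b} {B} (suc K) P {xs} pxs fibre with separate P pxs
  ... | ys , zs , xs↭ , pys , pzs = begin
    length xs * b              ≡⟨ cong (_* b) (trans (↭-length xs↭) (length-++ ys)) ⟩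
    (length ys + length zs) * b ≡⟨ *-distribʳ-+ b (length ys) (length zs) ⟩
    length ys * b + length zs * b ≤⟨ +-mono-≤ (first pys) (pigeonhole K (P ∘ suc) pzs (λ px → shrink (fibre px))) ⟩
    suc K * B ∎
    where
    open ≤-Reasoning
    ∑-xs : ∀ f → ∑ f xs ≡ ∑ f ys + ∑ f zs
    ∑-xs f = trans (∑-↭ f xs↭) (∑-++ f ys zs)
    shrink : ∀ {u : Fin K} → ∃[ f ] (∀ {y} → P (suc u) y → 1 ≤ f y) × ∑ f xs * b ≤ B →
             ∃[ f ] (∀ {y} → P (suc u) y → 1 ≤ f y) × ∑ f zs * b ≤ B
    shrink (f , pos , bound) = f , pos , ≤-trans (*-monoˡ-≤ b (≤-trans (m≤n+m (∑ f zs) (∑ f ys)) (≤-reflexive (sym (∑-xs f))))) bound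
    first : All (P zero) ys → length ys * b ≤ B
    first []                  = z≤n
    first pys@(_∷_ {x} {xs = ys′} px _) with f , pos , bound ← fibre px = ≤-trans (*-monoˡ-≤ b (begin
      length (x ∷ ys′)        ≡⟨ trans (sym (*-identityʳ _)) (sym (∑-const 1 (x ∷ ys′))) ⟩
      ∑ (λ _ → 1) (x ∷ ys′)   ≤⟨ ∑-mono (x ∷ ys′) (λ y∈ → pos (lookup pys y∈)) ⟩
      ∑ f (x ∷ ys′)           ≤⟨ m≤m+n _ (∑ f zs) ⟩
      ∑ f (x ∷ ys′) + ∑ f zs  ≡⟨ ∑-xs f ⟨
      ∑ f xs ∎)) bound

-- Permutations whose paths use the same gate

module _ {n : ℕ} where

  open Supports (_≟ᴱ_ {2 + n})
  open DecMembership (_≟ᴱ_ {2 + n}) using (_∈?_)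

  inner-! : ∀ {is} → Unique is → Unique (map (inner {n}) is)
  inner-! = Unique-map⁺ (λ eq → inject₁-injective (Fin-suc-injective eq))

  s∉inner : ∀ is → s ∉ map (inner {n}) is
  s∉inner is s∈ with _ , _ , () ← ∈-map⁻ inner s∈

  t∉inner : ∀ is → t ∉ map (inner {n}) is
  t∉inner is t∈ with _ , _ , eq ← ∈-map⁻ inner t∈ = fromℕ≢inject₁ (Fin-suc-injective eq)

  ∉⇒All≢ : ∀ {v : Fin (2 + n)} {vs} → v ∉ vs → All (v ≢_) vs
  ∉⇒All≢ v∉vs = tabulate λ { v∈vs refl → v∉vs v∈vs }

  route-! : ∀ {is} → Unique is → Unique (route {n} is)
  route-! {is} is! =
    ∉⇒All≢ s∉ ∷ Unique-++⁺ (inner-! is!) ([] ∷ []) (λ { (v∈ , here refl) → t∉inner is v∈ })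
    where
    s∉ : s ∉ map inner is ++ [ t ]
    s∉ s∈ with ∈-++⁻ (map inner is) s∈
    ... | inj₁ s∈is     = s∉inner is s∈is
    ... | inj₂ (here ())

  module Permuted {size : ℕ} (gs : Gates (Edge (2 + n)) size) (x : Source (Edge (2 + n)) size)
    (counts : producedAt gs x ≈₀₁ Path n)
    (k j : ℕ) (1≤k : 1 ≤ k) (2N≤n : (k + j) + (k + j) ≤ n)
    (cs rs : List (Fin n)) (|cs| : length cs ≡ k + j) (|rs| : length rs ≡ k + j) 
    (cs! : Unique cs) (rs! : Unique rs) (cs++rs! : Unique (cs ++ rs)) where

    N κ : ℕ
    N = k + j
    -- By `weight-≤-support`, weight `2 * k + 1` forces at least `k` suspect cells.
    κ = 2 * k + 1

    zigzag : List (Fin n) → List (Fin n)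
    zigzag σ = interleave σ rs

    zigzag-↭ : ∀ {σ} → σ ↭ cs → zigzag σ ↭ cs ++ rs
    zigzag-↭ {σ} σ↭ = ↭-trans (interleave-↭ σ rs (trans (↭-length σ↭) (trans |cs| (sym |rs|)))) (++⁺ʳ rs σ↭)

    length-zigzag : ∀ {σ} → σ ↭ cs → length (zigzag σ) ≡ N + N
    length-zigzag σ↭ = trans (↭-length (zigzag-↭ σ↭)) (trans (length-++ cs) (cong₂ _+_ |cs| |rs|))

    zigzag-! : ∀ {σ} → σ ↭ cs → Unique (route (zigzag σ))
    zigzag-! σ↭ = route-! (Unique-resp-↭ (↭-sym (zigzag-↭ σ↭)) cs++rs!)

    -- All zigzag paths visit the same vertices, so the edges of one have both ends on any other, as
    -- `exchanged-edge` requires.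
    route-↭ : ∀ {σ τ} → σ ↭ cs → τ ↭ cs → route (zigzag σ) ↭ route (zigzag τ)
    route-↭ σ↭ τ↭ = prep s (++⁺ʳ [ t ] (map⁺ inner (↭-trans (zigzag-↭ σ↭) (↭-sym (zigzag-↭ τ↭)))))

    length-path : ∀ {σ} → σ ↭ cs → (p : Unique (route (zigzag σ))) → length (pathMonomial (route (zigzag σ)) p) ≡ N + N + 1
    length-path {σ} σ↭ p = trans (length-pathMonomial s _ p) (trans (length-++ (map inner (zigzag σ)))
      (cong (_+ 1) (trans (length-map inner (zigzag σ)) (length-zigzag σ↭))))

    path-heavy : ∀ {σ} → σ ↭ cs → (p : Unique (route (zigzag σ))) → ∀ {m} →
                 pathMonomial (route (zigzag σ)) p ⊆ m → κ ≤ weight (pathMonomial (route (zigzag σ)) p) m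
    path-heavy {σ} σ↭ p {m} P⊆m = begin
      2 * k + 1    ≤⟨ +-monoˡ-≤ 1 (≤-trans (≤-reflexive (cong (k +_) (+-identityʳ k))) (+-mono-≤ (m≤m+n k j) (m≤m+n k j))) ⟩
      N + N + 1    ≡⟨ length-path σ↭ p ⟨
      length (pathMonomial (route (zigzag σ)) p) ≡⟨ weight-full P⊆m ⟨
      weight (pathMonomial (route (zigzag σ)) p) m ∎
      where open ≤-Reasoning

    -- The proof `path!` is stored because `∈-Path⁺` supplies the monomial of the path with a
    -- distinctness proof of its own. A permutation may be charged to several gates.
    record Charged (u : Fin size) (σ : List (Fin n)) : Set where
      field
        σ↭    : σ ↭ cs
        path! : Unique (route (zigzag σ))
      path : Monomial (Edge (2 + n))
      path = pathMonomial (route (zigzag σ)) path!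
      field
        {whole part} : Monomial (Edge (2 + n))
        supported    : path ≐ whole
        factor       : Factor gs x u part whole
        heavy        : κ ≤ weight path part
        light        : weight path part ≤ 2 * κ

    charge : ∀ {σ} → σ ↭ cs → ∃[ u ] Charged u σ
    charge {σ} σ↭
      with p , P∈ ← ∈-Path⁺ (zigzag σ) (≤-trans (≤-reflexive (length-zigzag σ↭)) 2N≤n) (zigzag-! σ↭)
      with m , m∈ , P≐m ← proj₂ (same-supports (producedAt gs x) (Path n) counts) P∈
      with u , a , f , heavy , light ← medium-factor (pathMonomial (route (zigzag σ)) p) (pathMonomial-! _ p) κ
             (+-monoˡ-≤ 1 (≤-trans 1≤k (m≤m+n k _))) gs x m∈ (path-heavy σ↭ p (proj₁ P≐m))
      = u , record { σ↭ = σ↭ ; path! = p ; supported = P≐m ; factor = f ; heavy = heavy ; light = light }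

    -- A bound for the total weight of all cells, from `∑-suspects` and `∑∑-suspect`: a path has
    -- `N + N + 1` edges, and at most `2 * κ` of them lie in the part.
    cells : ℕ
    cells = 2 * (2 * (N + N + 1) + (2 * (2 * κ)) * (2 * (2 * κ)))

    module _ {u : Fin size} {σ : List (Fin n)} (X : Charged u σ) where
      open Charged X

      touched : Monomial (Edge (2 + n))
      touched = filter (_∈? part) path

      rows : List (Fin n → ℕ)
      rows = suspects path touched s rs

      -- The part of `τ` in the context of `σ` is produced at `x`, so by `same-supports` it has the
      -- support of some path. Hence the edges of the part of `τ` that join vertices of the route
      -- are suspect with respect to `σ`, and its weight `κ` yields `k` suspect cells.
      charged-positive : ∀ {τ} → Charged u τ → 1 ≤ esym k (weights rows τ)
      charged-positive {τ} Y
        with l , l∈ , l≐ ← exchange factor (a-produced (Charged.factor Y))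
        with g , g∈ , l≐g ← proj₁ (same-supports (producedAt gs x) (Path n) counts) l∈
        with ws , q , refl ← ∈-Path⁻ g∈
        = esym-positive k (weights rows τ) (*-cancelˡ-≤ 2 (+-cancelʳ-≤ 1 (2 * k) _ (≤-trans (Charged.heavy Y)
            (weight-≤-support path touched (Charged.part Y) s τ rs (Charged.path! Y) λ v≢w v∈ w∈ →
              exchanged-edge path! q part (Charged.part Y) (context factor) (≐-trans supported (factors factor))
                (≐-trans (≐-sym l≐g) l≐) v≢w
                (∈-resp-↭ (route-↭ (Charged.σ↭ Y) σ↭) v∈) (∈-resp-↭ (route-↭ (Charged.σ↭ Y) σ↭) w∈)))))

      charged-few : ∑ (esym k ∘ weights rows) (perms N cs) * k ! ≤ j ! * cells ^ k
      charged-few = begin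
        ∑ (esym k ∘ weights rows) (perms N cs) * k !
          ≤⟨ *-monoˡ-≤ (k !) (∑-esym-perms k j rows cs (trans (length-suspects path touched s rs) |rs|) |cs|) ⟩
        j ! * matchings k rows cs * k !
          ≡⟨ trans (*-assoc (j !) _ (k !)) (cong (j ! *_) (*-comm _ (k !))) ⟩
        j ! * (k ! * matchings k rows cs)
          ≤⟨ *-monoʳ-≤ (j !) (≤-trans (matchings-≤ k rows cs) (^-monoˡ-≤ k (begin
            ∑ (λ D → ∑ D cs) rows
              ≤⟨ ∑-suspects path touched s rs cs ⟩
            2 * ∑ (λ r → ∑ (suspect path touched r) (map inner cs)) (s ∷ map inner rs)
              ≤⟨ *-monoʳ-≤ 2 (∑∑-suspect path touched (∉⇒All≢ (s∉inner rs) ∷ inner-! rs!) (inner-! cs!)) ⟩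
            2 * (2 * length path + (2 * length touched) * (2 * length touched))
              ≤⟨ *-monoʳ-≤ 2 (+-mono-≤ (*-monoʳ-≤ 2 (≤-reflexive (length-path σ↭ path!)))
                                           (*-mono-≤ (*-monoʳ-≤ 2 light) (*-monoʳ-≤ 2 light))) ⟩
            cells ∎))) ⟩
        j ! * cells ^ k ∎
        where open ≤-Reasoning

    permutations-≤ : N ! * k ! ≤ size * (j ! * cells ^ k)
    permutations-≤ = subst (λ l → l * k ! ≤ size * (j ! * cells ^ k)) |perms|
      (pigeonhole size Charged {perms N cs} (tabulate (λ σ∈ → charge (perms-↭ cs |cs| σ∈)))
        (λ X → esym k ∘ weights (rows X) , charged-positive X , charged-few X))
      where
      |perms| : length (perms N cs) ≡ N !
      |perms| = trans (sym (*-identityʳ _)) (trans (sym (∑-const 1 (perms N cs)))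
        (trans (∑-perms-const 1 N cs |cs|) (*-identityʳ (N !))))

-- Choice of parameters and numerical estimates

module _ {A : Set} where

  take-++-drop : ∀ m n (xs : List A) → take m xs ++ take n (drop m xs) ≡ take (m + n) xs
  take-++-drop zero    n xs       = refl
  take-++-drop (suc m) n []       = take-[] n
  take-++-drop (suc m) n (x ∷ xs) = cong (x ∷_) (take-++-drop m n xs)

-- The `k` largest factors of `(k + j) !` all exceed `j`.
!-lower : ∀ j k → j ! * j ^ k ≤ (k + j) !
!-lower j zero    = ≤-reflexive (*-identityʳ (j !))
!-lower j (suc k) = begin
  j ! * (j * j ^ k)       ≡⟨ lemma (j !) j (j ^ k) ⟩
  j * (j ! * j ^ k)       ≤⟨ *-mono-≤ (m≤n⇒m≤1+n (m≤n+m j k)) (!-lower j k) ⟩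
  suc (k + j) * (k + j) ! ∎
  where
  open ≤-Reasoning
  lemma : ∀ a b c → a * (b * c) ≡ b * (a * c)
  lemma = solve-∀

-- The case 120, where `k / e` exceeds 40, is settled by evaluation; afterwards every new factor of
-- the factorial is larger than 40.
40^≤! : ∀ k → 120 ≤ k → 40 ^ k ≤ k !
40^≤! k 120≤k = subst (λ k → 40 ^ k ≤ k !) (m∸n+n≡m 120≤k) (go (k ∸ 120))
  where
  go : ∀ i → 40 ^ (i + 120) ≤ (i + 120) !
  go zero    = ≤ᵇ⇒≤ (40 ^ 120) (120 !) tt
  go (suc i) = *-mono-≤ {40} {suc (i + 120)} (m≤n⇒m≤1+n (≤-trans (≤ᵇ⇒≤ 40 120 tt) (m≤n+m 120 i))) (go i)

^-*-distrib : ∀ a b k → (a * b) ^ k ≡ a ^ k * b ^ k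
^-*-distrib a b zero    = refl
^-*-distrib a b (suc k) = trans (cong (a * b *_) (^-*-distrib a b k)) (lemma a b (a ^ k) (b ^ k))
  where
  lemma : ∀ a b c d → a * b * (c * d) ≡ a * c * (b * d)
  lemma = solve-∀

-- As `cells` is at most `20 * j`, dividing `permutations-≤` by `j ! * j ^ k`, a lower bound for
-- `(k + j) !`, leaves `k !` at most `20 ^ k` times the size. Comparison with `40 ^ k` then gives
-- `2 ^ k`.
counting-size : ∀ n k → 120 ≤ k → 576 * (k * k) ≤ n → (C : Circuit (Edge (2 + n))) → Counts C (Path n) → 2 ^ k ≤ size C
counting-size n k 120≤k 2N≤n (circuit {K} gs out) counts = *-cancelʳ-≤ (2 ^ k) K (20 ^ k) {{m^n≢0 20 k}} (begin
  2 ^ k * 20 ^ k  ≡⟨ ^-*-distrib 2 20 k ⟨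
  40 ^ k          ≤⟨ 40^≤! k 120≤k ⟩
  k !             ≤⟨ *-cancelˡ-≤ (j ! * j ^ k) {{m*n≢0 (j !) (j ^ k) {{j !≢0}} {{m^n≢0 j k {{j≢0}}}}}} main ⟩
  K * 20 ^ k      ∎)
  where
  open ≤-Reasoning
  N j : ℕ
  -- Rows and columns together take up `576 * (k * k)` nodes. The factor 288 is 32 times 9: the term
  -- `32 * (2k+1)²` in `cells` is at most `288 * k²`, and all of `cells` is then at most `10 * N`.
  N = 288 * (k * k)
  j = N ∸ k
  1≤k : 1 ≤ k
  1≤k = ≤-trans (≤ᵇ⇒≤ 1 120 tt) 120≤k
  k≤k² : k ≤ k * k
  k≤k² = m≤m*n k k {{>-nonZero 1≤k}}
  k+k≤N : k + k ≤ N
  k+k≤N = begin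
    k + k            ≤⟨ +-mono-≤ k≤k² k≤k² ⟩
    k * k + k * k    ≡⟨ cong (k * k +_) (+-identityʳ (k * k)) ⟨
    2 * (k * k)      ≤⟨ *-monoˡ-≤ (k * k) (≤ᵇ⇒≤ 2 288 tt) ⟩
    N                ∎
  k+j≡N : k + j ≡ N
  k+j≡N = m+[n∸m]≡n (≤-trans (m≤m+n k k) k+k≤N)
  k≤j : k ≤ j
  k≤j = +-cancelˡ-≤ k k j (≤-trans k+k≤N (≤-reflexive (sym k+j≡N)))
  j≢0 : NonZero j
  j≢0 = >-nonZero (≤-trans 1≤k k≤j)
  N≤2j : k + j ≤ 2 * j
  N≤2j = ≤-trans (+-monoˡ-≤ j k≤j) (≤-reflexive (cong (j +_) (sym (+-identityʳ j))))
  N+N≤n : (k + j) + (k + j) ≤ n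
  N+N≤n = ≤-trans (≤-reflexive (trans (cong₂ _+_ k+j≡N k+j≡N) (sym (*-distribʳ-+ (k * k) 288 288)))) 2N≤n
  all cs rs : List (Fin n)
  all = allFin n
  cs = take (k + j) all
  rs = take (k + j) (drop (k + j) all)
  |all| : length all ≡ n
  |all| = length-tabulate (λ i → i)
  |cs| : length cs ≡ k + j
  |cs| = trans (length-take (k + j) all) (m≤n⇒m⊓n≡m (≤-trans (≤-trans (m≤m+n (k + j) _) N+N≤n) (≤-reflexive (sym |all|))))
  |rs| : length rs ≡ k + j
  |rs| = trans (length-take (k + j) (drop (k + j) all)) (m≤n⇒m⊓n≡m (≤-trans (m+n≤o⇒m≤o∸n (k + j) N+N≤n)
           (≤-reflexive (sym (trans (length-drop (k + j) all) (cong (_∸ (k + j)) |all|))))))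
  open Permuted gs out counts k j 1≤k N+N≤n cs rs |cs| |rs| (take⁺ (k + j) (allFin⁺ n)) (take⁺ (k + j) (drop⁺ (k + j) (allFin⁺ n)))
    (subst Unique (sym (take-++-drop (k + j) (k + j) all)) (take⁺ (k + j + (k + j)) (allFin⁺ n)))
    using (cells; permutations-≤)
  cells≤20j : cells ≤ 20 * j
  cells≤20j = begin
    cells
      ≡⟨ lemma₁ k (k + j) ⟩
    8 * (k + j) + (4 + 32 * ((2 * k + 1) * (2 * k + 1)))
      ≤⟨ +-monoʳ-≤ (8 * (k + j)) (+-mono-≤ (*-monoʳ-≤ 4 (*-mono-≤ 1≤k 1≤k)) (*-monoʳ-≤ 32 (*-mono-≤ 2k+1≤3k 2k+1≤3k))) ⟩
    8 * (k + j) + (4 * (k * k) + 32 * (3 * k * (3 * k)))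
      ≡⟨ cong (λ a → 8 * (k + j) + (4 * (k * k) + 32 * a)) (lemma₂ k) ⟩
    8 * (k + j) + (4 * (k * k) + 32 * (9 * (k * k)))
      ≡⟨ cong (λ a → 8 * (k + j) + (4 * (k * k) + a)) (*-assoc 32 9 (k * k)) ⟨
    8 * (k + j) + (4 * (k * k) + 288 * (k * k))
      ≡⟨ cong (8 * (k + j) +_) (*-distribʳ-+ (k * k) 4 288) ⟨
    8 * (k + j) + 292 * (k * k)
      ≤⟨ +-monoʳ-≤ (8 * (k + j)) (*-monoˡ-≤ (k * k) (≤ᵇ⇒≤ 292 576 tt)) ⟩
    8 * (k + j) + 576 * (k * k)
      ≡⟨ cong (8 * (k + j) +_) (*-assoc 2 288 (k * k)) ⟩
    8 * (k + j) + 2 * N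
      ≡⟨ cong (λ N → 8 * (k + j) + 2 * N) k+j≡N ⟨
    8 * (k + j) + 2 * (k + j)
      ≤⟨ +-mono-≤ (*-monoʳ-≤ 8 N≤2j) (*-monoʳ-≤ 2 N≤2j) ⟩
    8 * (2 * j) + 2 * (2 * j)
      ≡⟨ lemma₄ j ⟩
    20 * j ∎
    where
    lemma₁ : ∀ k N → 2 * (2 * (N + N + 1) + (2 * (2 * (2 * k + 1))) * (2 * (2 * (2 * k + 1))))
                     ≡ 8 * N + (4 + 32 * ((2 * k + 1) * (2 * k + 1)))
    lemma₁ = solve-∀
    lemma₂ : ∀ k → 3 * k * (3 * k) ≡ 9 * (k * k)
    lemma₂ = solve-∀
    lemma₄ : ∀ j → 8 * (2 * j) + 2 * (2 * j) ≡ 20 * j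
    lemma₄ = solve-∀
    2k+1≤3k : 2 * k + 1 ≤ 3 * k
    2k+1≤3k = ≤-trans (+-monoʳ-≤ (2 * k) 1≤k) (≤-reflexive (lemma₅ k))
      where
      lemma₅ : ∀ k → 2 * k + k ≡ 3 * k
      lemma₅ = solve-∀
  main : j ! * j ^ k * k ! ≤ j ! * j ^ k * (K * 20 ^ k)
  main = begin
    j ! * j ^ k * k !           ≤⟨ *-monoˡ-≤ (k !) (!-lower j k) ⟩
    (k + j) ! * k !             ≤⟨ permutations-≤ ⟩
    K * (j ! * cells ^ k)       ≤⟨ *-monoʳ-≤ K (*-monoʳ-≤ (j !) (^-monoˡ-≤ k cells≤20j)) ⟩
    K * (j ! * (20 * j) ^ k)    ≡⟨ cong (λ h → K * (j ! * h)) (^-*-distrib 20 j k) ⟩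
    K * (j ! * (20 ^ k * j ^ k)) ≡⟨ lemma K (j !) (20 ^ k) (j ^ k) ⟩
    j ! * j ^ k * (K * 20 ^ k)  ∎
    where
    lemma : ∀ a b c d → a * (b * (c * d)) ≡ b * d * (a * c)
    lemma = solve-∀

scale : ∀ n → ∃[ k ] 576 * (k * k) ≤ n × n < 576 * (suc k * suc k)
scale zero = 0 , z≤n , z<s
scale (suc n) with k , lower , upper ← scale n with suc n <? 576 * (suc k * suc k)
... | yes n< = k , m≤n⇒m≤1+n lower , n<
... | no  n≮ = suc k , ≮⇒≥ n≮ , ≤-<-trans upper (*-monoʳ-< 576 (*-mono-< (n<1+n (suc k)) (n<1+n (suc k))))

-- From here on `scale` yields `k` at least 2304, which is 4 times 576, so that `576 * (2k)²` is at
-- most `k ^ 3`.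
threshold : ℕ
threshold = 576 * (2304 * 2304)

-- The `k` from `scale` is of the order of the square root of `n`. Any exponent below 1/2 would be
-- reached eventually; with 1/3 the surplus absorbs the constant 576.
cube-root : ∀ n → threshold ≤ n → ∃[ k ] 120 ≤ k × 576 * (k * k) ≤ n × n ≤ k ^ 3
cube-root n n≥ with k , lower , upper ← scale n = k , ≤-trans (≤ᵇ⇒≤ 120 2304 tt) k≥ , lower , (begin
  n                               ≤⟨ <⇒≤ upper ⟩
  576 * (suc k * suc k)           ≤⟨ *-monoʳ-≤ 576 (*-mono-≤ 1+k≤2k 1+k≤2k) ⟩
  576 * ((k + k) * (k + k))       ≡⟨ lemma₁ k ⟩
  2304 * (k * k)                  ≤⟨ *-monoˡ-≤ (k * k) k≥ ⟩
  k * (k * k)                     ≡⟨ lemma₂ k ⟩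
  k ^ 3                           ∎)
  where
  open ≤-Reasoning
  k≥ : 2304 ≤ k
  k≥ = ≮⇒≥ λ k< → <⇒≱ (<-≤-trans upper (*-monoʳ-≤ 576 {suc k * suc k} {2304 * 2304} (*-mono-≤ {suc k} {2304} k< k<))) n≥
  1+k≤2k : suc k ≤ k + k
  1+k≤2k = +-monoˡ-≤ k (≤-trans (≤ᵇ⇒≤ 1 2304 tt) k≥)
  lemma₁ : ∀ k → 576 * ((k + k) * (k + k)) ≡ 2304 * (k * k)
  lemma₁ = solve-∀
  lemma₂ : ∀ k → k * (k * k) ≡ k * (k * (k * 1))
  lemma₂ = solve-∀

^-cancelˡ-≤ : ∀ b .{{_ : NonZero b}} {p q} → p ^ b ≤ q ^ b → p ≤ q
^-cancelˡ-≤ b p^b≤q^b = ≮⇒≥ λ q<p → <⇒≱ (^-monoˡ-< b q<p) p^b≤q^b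

counting-lower : ∀ n k → 120 ≤ k → 576 * (k * k) ≤ n → n ≤ k ^ 3 → C₀₁[ Path n ]≥ 2^[ n ^[ 1 / 3 ]]
counting-lower n k 120≤k lower n≤k³ C counts p q p³≤nq³ = begin
  2 ^ p           ≤⟨ ^-monoʳ-≤ 2 p≤kq ⟩
  2 ^ (k * q)     ≡⟨ ^-*-assoc 2 k q ⟨
  (2 ^ k) ^ q     ≤⟨ ^-monoˡ-≤ q (counting-size n k 120≤k lower C counts) ⟩
  size C ^ q      ∎
  where
  open ≤-Reasoning
  p≤kq : p ≤ k * q
  p≤kq = ^-cancelˡ-≤ 3 (begin
    p ^ 3           ≤⟨ p³≤nq³ ⟩
    n ^ 1 * q ^ 3   ≡⟨ cong (_* q ^ 3) (^-identityʳ n) ⟩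
    n * q ^ 3       ≤⟨ *-monoˡ-≤ (q ^ 3) n≤k³ ⟩
    k ^ 3 * q ^ 3   ≡⟨ ^-*-distrib k q 3 ⟨
    (k * q) ^ 3     ∎)

-- Independence of path monomials from the proofs of distinctness

—-irrelevant : ∀ {m} {u v : Fin m} (p q : u ≢ v) → [ u — v ]⟨ p ⟩ ≡ [ u — v ]⟨ q ⟩
—-irrelevant {u = u} {v} p q with <-cmp u v
... | tri< _ _   _ = refl
... | tri≈ _ u≡v _ = contradiction u≡v p
... | tri> _ _   _ = refl

pathMonomial-irrelevant : ∀ {m} (vs : List (Fin m)) (p q : Unique vs) → pathMonomial vs p ≡ pathMonomial vs q
pathMonomial-irrelevant []           _             _               = refl
pathMonomial-irrelevant (u ∷ [])     _             _               = refl
pathMonomial-irrelevant (u ∷ v ∷ vs) ((p ∷ _) ∷ ps) ((q ∷ _) ∷ qs) =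
  cong₂ _∷_ (—-irrelevant p q) (pathMonomial-irrelevant (v ∷ vs) ps qs)

-- Polynomials nonzero at a 0/1 point

module _ {V : Set} where

  -- Equivalent to a nonzero value at `a`; the surviving monomial is kept as a witness, which passes
  -- directly through sums and products.
  Live : (V → Fin 2) → Poly V → Set
  Live a p = ∃[ m ] m ∈ p × On a m

  module _ {a : V → Fin 2} where

    live-var⁺ : ∀ {v} → a v ≡ suc zero → Live a (var v)
    live-var⁺ av = _ , here refl , λ { (here refl) → av }

    live-var⁻ : ∀ {v} → Live a (var v) → a v ≡ suc zero
    live-var⁻ (_ , here refl , on) = on (here refl)

    live-⊕⁺ˡ : ∀ {p} q → Live a p → Live a (p ⊕ q)
    live-⊕⁺ˡ q (m , m∈ , on) = m , ∈-++⁺ˡ m∈ , on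

    live-⊕⁺ʳ : ∀ p {q} → Live a q → Live a (p ⊕ q)
    live-⊕⁺ʳ p (m , m∈ , on) = m , ∈-++⁺ʳ p m∈ , on

    live-⊕⁻ : ∀ p {q} → Live a (p ⊕ q) → Live a p ⊎ Live a q
    live-⊕⁻ p (m , m∈ , on) with ∈-++⁻ p m∈
    ... | inj₁ m∈p = inj₁ (m , m∈p , on)
    ... | inj₂ m∈q = inj₂ (m , m∈q , on)

    live-⊗⁺ : ∀ {p q} → Live a p → Live a q → Live a (p ⊗ q)
    live-⊗⁺ (m , m∈ , on) (l , l∈ , on′) = m ++ l , ∈-cartesianProductWith⁺ _++_ m∈ l∈ , on-++
      where
      on-++ : On a (m ++ l)
      on-++ v∈ with ∈-++⁻ m v∈
      ... | inj₁ v∈m = on v∈m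
      ... | inj₂ v∈l = on′ v∈l

    live-⊗⁻ : ∀ p q → Live a (p ⊗ q) → Live a p × Live a q
    live-⊗⁻ p q (_ , m∈ , on) with m , l , m∈p , l∈q , refl ← ∈-cartesianProductWith⁻ _++_ p q m∈ =
      (m , m∈p , on ∘ ∈-++⁺ˡ) , (l , l∈q , on ∘ ∈-++⁺ʳ m)

  weaken : ∀ {k} → Source V k → Source V (suc k)
  weaken (inj₁ v) = inj₁ v
  weaken (inj₂ i) = inj₂ (suc i)

  producedAt-weaken : ∀ {k} (gs : Gates V k) g x → producedAt (gs ▷ g) (weaken x) ≡ producedAt gs x
  producedAt-weaken gs g (inj₁ v) = refl
  producedAt-weaken gs g (inj₂ i) = refl

length-cartesianProduct : ∀ {A B : Set} (xs : List A) (ys : List B) →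
                          length (cartesianProduct xs ys) ≡ length xs * length ys
length-cartesianProduct []       ys = refl
length-cartesianProduct (x ∷ xs) ys =
  trans (length-++ (map (x ,_) ys)) (cong₂ _+_ (length-map (x ,_) ys) (length-cartesianProduct xs ys))

unique-length : ∀ {n} {is : List (Fin n)} → Unique is → length is ≤ n
unique-length {n} {is} is! = begin
  length is              ≡⟨ trans (sym (*-identityʳ _)) (sym (∑-const 1 is)) ⟩
  ∑ (λ _ → 1) is         ≤⟨ ∑-⊆ (λ _ → 1) is! (λ {i} _ _ → ∈-allFin i) ⟩
  ∑ (λ _ → 1) (allFin n) ≡⟨ trans (∑-const 1 (allFin n)) (*-identityʳ _) ⟩
  length (allFin n)      ≡⟨ length-tabulate (λ i → i) ⟩
  n                      ∎
  where open ≤-Reasoning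

-- Shortest paths by relaxation

module Relaxation (n : ℕ) where

  Vertex : Set
  Vertex = Fin (2 + n)

  record State : Set where
    constructor state
    field
      {gateCount} : ℕ
      gates       : Gates (Edge (2 + n)) gateCount
      wire        : Vertex → Source (Edge (2 + n)) gateCount
    at : Vertex → Poly (Edge (2 + n))
    at v = producedAt gates (wire v)

  open State

  s≢t : s ≢ t {n}
  s≢t ()

  -- The wire at t is a junk value; no other wire depends on it.
  initial : State
  initial = state [] λ v → inj₁ (toT v)
    where
    toT : Vertex → Edge (2 + n)
    toT v with v ≟ t
    ... | yes _   = [ s — t ]⟨ s≢t ⟩
    ... | no  v≢t = [ v — t ]⟨ v≢t ⟩

  module _ (S : State) {v w : Vertex} (v≢w : v ≢ w) where

    added : Gates (Edge (2 + n)) (2 + gateCount S)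
    added = gates S ▷ gate times (inj₁ [ v — w ]⟨ v≢w ⟩) (wire S w) ▷ gate plus (inj₂ zero) (weaken (wire S v))

    rewire : Vertex → Source (Edge (2 + n)) (2 + gateCount S)
    rewire u with u ≟ v
    ... | yes _ = inj₂ zero
    ... | no  _ = weaken (weaken (wire S u))

    relax-proper : State
    relax-proper = state added rewire

    at-v : at relax-proper v ≡ var [ v — w ]⟨ v≢w ⟩ ⊗ at S w ⊕ at S v
    at-v with v ≟ v
    ... | yes _   = cong (var [ v — w ]⟨ v≢w ⟩ ⊗ at S w ⊕_) (producedAt-weaken (gates S) _ (wire S v))
    ... | no  v≢v = contradiction refl v≢v

    at-other : ∀ {u} → u ≢ v → at relax-proper u ≡ at S u
    at-other {u} u≢v with u ≟ v
    ... | yes u≡v = contradiction u≡v u≢v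
    ... | no  _   = trans (producedAt-weaken _ _ (weaken (wire S u))) (producedAt-weaken (gates S) _ (wire S u))

  -- Pairs with `w ≡ t` are skipped because the wire at `t` is junk and the edges into `t` are
  -- already in the initial state. Pairs with `v ≡ t` merely change that junk.
  relax : Vertex × Vertex → State → State
  relax (v , w) S with v ≟ w | w ≟ t
  ... | no v≢w | no _ = relax-proper S v≢w
  ... | _      | _    = S

  run : List (Vertex × Vertex) → State → State
  run []       S = S
  run (p ∷ ps) S = run ps (relax p S)

  pairs : List (Vertex × Vertex)
  pairs = cartesianProduct (allFin (2 + n)) (allFin (2 + n))

  rounds : ℕ → State
  rounds zero    = initial
  rounds (suc r) = run pairs (rounds r)

  relax-size : ∀ p S → gateCount (relax p S) ≤ 2 + gateCount S
  relax-size (v , w) S with v ≟ w | w ≟ t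
  ... | no _  | no _  = ≤-refl
  ... | no _  | yes _ = m≤n+m _ 2
  ... | yes _ | yes _ = m≤n+m _ 2
  ... | yes _ | no  _ = m≤n+m _ 2

  run-size : ∀ ps S → gateCount (run ps S) ≤ length ps * 2 + gateCount S
  run-size []       S = ≤-refl
  run-size (p ∷ ps) S = begin
    gateCount (run ps (relax p S))           ≤⟨ run-size ps (relax p S) ⟩
    length ps * 2 + gateCount (relax p S)    ≤⟨ +-monoʳ-≤ (length ps * 2) (relax-size p S) ⟩
    length ps * 2 + (2 + gateCount S)        ≡⟨ lemma (length ps * 2) (gateCount S) ⟩
    2 + length ps * 2 + gateCount S          ∎
    where
    open ≤-Reasoning
    lemma : ∀ a b → a + (2 + b) ≡ 2 + a + b
    lemma = solve-∀

  length-pairs : length pairs ≡ (2 + n) * (2 + n)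
  length-pairs = trans (length-cartesianProduct (allFin (2 + n)) (allFin (2 + n)))
    (cong₂ _*_ (length-tabulate {n = 2 + n} (λ i → i)) (length-tabulate {n = 2 + n} (λ i → i)))

  rounds-size : ∀ r → gateCount (rounds r) ≤ r * ((2 + n) * (2 + n) * 2)
  rounds-size zero    = z≤n
  rounds-size (suc r) = ≤-trans (run-size pairs (rounds r))
    (+-mono-≤ (≤-reflexive (cong (_* 2) length-pairs)) (rounds-size r))

  module _ (a : Edge (2 + n) → Fin 2) where

    -- The old polynomial at `v` remains as a summand, so no later update can destroy a path already
    -- found.
    relax-mono : ∀ p S {u} → Live a (at S u) → Live a (at (relax p S) u)
    relax-mono (v , w) S {u} live with v ≟ w | w ≟ t
    ... | no v≢w | no _  = go (u ≟ v)
      where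
      go : Dec (u ≡ v) → Live a (at (relax-proper S v≢w) u)
      go (yes refl) = subst (Live a) (sym (at-v S v≢w)) (live-⊕⁺ʳ (var [ v — w ]⟨ v≢w ⟩ ⊗ at S w) live)
      go (no u≢v)   = subst (Live a) (sym (at-other S v≢w u≢v)) live
    ... | no _  | yes _ = live
    ... | yes _ | yes _ = live
    ... | yes _ | no  _ = live

    relax-gain : ∀ {v w} S (v≢w : v ≢ w) → w ≢ t → a [ v — w ]⟨ v≢w ⟩ ≡ suc zero →
                 Live a (at S w) → Live a (at (relax (v , w) S) v)
    relax-gain {v} {w} S v≢w w≢t on live with v ≟ w | w ≟ t
    ... | no v≢w′ | no _     = subst (Live a) (sym (at-v S v≢w′)) (live-⊕⁺ˡ (at S v)
                                (live-⊗⁺ (live-var⁺ (trans (cong a (—-irrelevant v≢w′ v≢w)) on)) live))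
    ... | no _    | yes w≡t  = contradiction w≡t w≢t
    ... | yes v≡w | yes _    = contradiction v≡w v≢w
    ... | yes v≡w | no  _    = contradiction v≡w v≢w

    run-mono : ∀ ps S {u} → Live a (at S u) → Live a (at (run ps S) u)
    run-mono []       S live = live
    run-mono (p ∷ ps) S live = run-mono ps (relax p S) (relax-mono p S live)

    run-gain : ∀ {ps v w} S → (v , w) ∈ ps → (v≢w : v ≢ w) → w ≢ t → a [ v — w ]⟨ v≢w ⟩ ≡ suc zero →
               Live a (at S w) → Live a (at (run ps S) v)
    run-gain {_ ∷ ps} S (here refl) v≢w w≢t on live = run-mono ps _ (relax-gain S v≢w w≢t on live)
    run-gain {p ∷ ps} S (there vw∈) v≢w w≢t on live = run-gain (relax p S) vw∈ v≢w w≢t on (relax-mono p S live)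

    rounds-mono : ∀ {r r′ u} → r ≤′ r′ → Live a (at (rounds r) u) → Live a (at (rounds r′) u)
    rounds-mono (≤′-reflexive refl) live = live
    rounds-mono (≤′-step {n = r} r≤) live = run-mono pairs (rounds r) (rounds-mono r≤ live)

    -- One round per vertex of `vs`: once the rest of the path is live at `w`, the next round also
    -- relaxes the pair `(v , w)`, in whatever order the pairs come.
    complete : ∀ v vs (p : Unique (v ∷ vs ++ [ t ])) → On a (pathMonomial (v ∷ vs ++ [ t ]) p) →
               Live a (at (rounds (length vs)) v)
    complete v [] ((v≢t ∷ _) ∷ _) on with v ≟ t
    ... | yes v≡t  = contradiction v≡t v≢t
    ... | no  v≢t′ = live-var⁺ (trans (cong a (—-irrelevant v≢t′ v≢t)) (on (here refl)))
    complete v (w ∷ vs) ((v≢w ∷ _) ∷ p@(w∉ ∷ _)) on =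
      run-gain (rounds (length vs)) (∈-cartesianProduct⁺ (∈-allFin v) (∈-allFin w)) v≢w
      (lookup w∉ (∈-++⁺ʳ vs (here refl))) (on (here refl)) (complete w vs p (on ∘ there))

    Connected : Vertex → Set
    Connected v = ∃[ vs ] ∃[ p ] On a (pathMonomial (v ∷ vs ++ [ t ]) p)

    suffix : ∀ {v} w vs p → On a (pathMonomial (w ∷ vs ++ [ t ]) p) → v ∈ vs → Connected v
    suffix w (x ∷ vs) ((_ ∷ _) ∷ p) on (here refl)  = vs , p , on ∘ there
    suffix w (x ∷ vs) ((_ ∷ _) ∷ p) on (there v∈vs) = suffix x vs p (on ∘ there) v∈vs

    -- If `v` already lies on the path from `w`, prepending the edge would close a cycle; the part
    -- of that path from `v` on is taken instead. Thus walks are reduced to simple paths.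
    connect : ∀ {v w} (v≢w : v ≢ w) → v ≢ t → a [ v — w ]⟨ v≢w ⟩ ≡ suc zero → Connected w → Connected v
    connect {v} {w} v≢w v≢t av (vs , p , on) with v ∈? vs
      where open DecMembership (_≟_ {2 + n}) using (_∈?_)
    ... | yes v∈vs = suffix w vs p on v∈vs
    ... | no  v∉vs = w ∷ vs , (v≢w ∷ ∉⇒All≢ {n} v∉) ∷ p , λ { (here refl) → av ; (there e∈) → on e∈ }
      where
      v∉ : v ∉ vs ++ [ t ]
      v∉ v∈ with ∈-++⁻ vs v∈
      ... | inj₁ v∈vs        = v∉vs v∈vs
      ... | inj₂ (here v≡t) = v≢t v≡t

    Sound : State → Set
    Sound S = ∀ {v} → v ≢ t → Live a (at S v) → Connected v

    relax-sound : ∀ p S → Sound S → Sound (relax p S)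
    relax-sound (v , w) S sound {u} u≢t live with v ≟ w | w ≟ t
    ... | no v≢w | no w≢t  = go (u ≟ v)
      where
      go : Dec (u ≡ v) → Connected u
      go (no u≢v) = sound u≢t (subst (Live a) (at-other S v≢w u≢v) live)
      go (yes refl) with live-⊕⁻ (var [ v — w ]⟨ v≢w ⟩ ⊗ at S w) (subst (Live a) (at-v S v≢w) live)
      ... | inj₂ live-v = sound u≢t live-v
      ... | inj₁ live-vw with live-e , live-w ← live-⊗⁻ (var [ v — w ]⟨ v≢w ⟩) (at S w) live-vw =
        connect v≢w u≢t (live-var⁻ live-e) (sound w≢t live-w)
    ... | no _  | yes _ = sound u≢t live
    ... | yes _ | yes _ = sound u≢t live
    ... | yes _ | no  _ = sound u≢t live

    run-sound : ∀ ps S → Sound S → Sound (run ps S)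
    run-sound []       S sound = sound
    run-sound (p ∷ ps) S sound = run-sound ps (relax p S) (relax-sound p S sound)

    initial-sound : Sound initial
    initial-sound {v} v≢t live with v ≟ t
    ... | yes v≡t  = contradiction v≡t v≢t
    ... | no  v≢t′ = [] , (v≢t′ ∷ []) ∷ [] ∷ [] , λ { (here refl) → live-var⁻ live }

    rounds-sound : ∀ r → Sound (rounds r)
    rounds-sound zero    = initial-sound
    rounds-sound (suc r) = run-sound pairs (rounds r) (rounds-sound r)

  inner-or-end : ∀ v → v ≢ s → v ≢ t → ∃[ i ] v ≡ inner {n} i
  inner-or-end zero    v≢s v≢t = contradiction refl v≢s
  inner-or-end (suc u) v≢s v≢t with view u
  ... | ‵fromℕ     = contradiction refl v≢t
  ... | ‵inject₁ i = i , refl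

  inner-list : ∀ vs → s ∉ vs → t ∉ vs → ∃[ is ] vs ≡ map (inner {n}) is
  inner-list []       _  _  = [] , refl
  inner-list (v ∷ vs) s∉ t∉
    with i  , refl ← inner-or-end v (λ v≡s → s∉ (here (sym v≡s))) (λ v≡t → t∉ (here (sym v≡t)))
       | is , refl ← inner-list vs (s∉ ∘ there) (t∉ ∘ there) = i ∷ is , refl

  -- Distinctness keeps both `s` and `t` out of the middle of the path.
  route-inner : ∀ {vs} → Unique (s ∷ vs ++ [ t {n} ]) → ∃[ is ] vs ≡ map inner is
  route-inner {vs} (s∉ ∷ vs!) = inner-list vs (λ s∈ → lookup s∉ (∈-++⁺ˡ s∈) refl) (t-last vs vs!)
    where
    t-last : ∀ vs → Unique (vs ++ [ t ]) → t ∉ vs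
    t-last (v ∷ vs) (v∉ ∷ _)  (here refl) = lookup v∉ (∈-++⁺ʳ vs (here refl)) refl
    t-last (v ∷ vs) (_ ∷ vs!) (there t∈)  = t-last vs vs! t∈

  route-!⁻ : ∀ {is} → Unique (route {n} is) → Unique is
  route-!⁻ {[]}     _               = []
  route-!⁻ {i ∷ is} (s∉ ∷ (i∉ ∷ p)) =
    tabulate (λ { j∈ refl → lookup i∉ (∈-++⁺ˡ (∈-map⁺ inner j∈)) refl }) ∷
    route-!⁻ {is} (tabulate (λ v∈ → lookup s∉ (there v∈)) ∷ p)

  decider : Circuit (Edge (2 + n))
  -- A simple path has at most `n` vertices between `s` and `t`, so `n` rounds suffice.
  decider = circuit (gates (rounds n)) (wire (rounds n) s)

  decides : Decides decider (Path n)
  decides a = mk⇔ to from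
    where
    F = produced decider
    to : eval₀₁ F a ≡ 0 → eval₀₁ (Path n) a ≡ 0
    to F≡0 with eval₀₁ (Path n) a ≟ᴺ 0
    ... | yes eq = eq
    ... | no  nz with g , g∈ , on ← eval₀₁≢0⁻ (Path n) nz with is , p , refl ← ∈-Path⁻ g∈
      with m , m∈ , on-m ← 
             rounds-mono a (≤⇒≤′ (subst (_≤ n) (sym (length-map inner is)) (unique-length (route-!⁻ p))))
               (complete a s (map inner is) p on)
      = contradiction F≡0 (eval₀₁≢0⁺ m∈ on-m)
    from : eval₀₁ (Path n) a ≡ 0 → eval₀₁ F a ≡ 0
    from f≡0 with eval₀₁ F a ≟ᴺ 0
    ... | yes eq = eq
    ... | no  nz with vs , p , on ← rounds-sound a n s≢t (eval₀₁≢0⁻ F nz)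
      with is , refl ← route-inner p
      with p′ , g∈ ← ∈-Path⁺ is (unique-length (route-!⁻ p)) p
      = contradiction f≡0 (eval₀₁≢0⁺ g∈ (subst (On a) (pathMonomial-irrelevant _ p p′) on))

  -- Each of the `n` rounds spends at most two gates on each of the `(2 + n) * (2 + n)` pairs, and
  -- `2 + n` is at most `3 * n`; the constant is 2 times 9.
  decider-size : 1 ≤ n → size decider ≤ 18 * n ^ 3
  decider-size 1≤n = begin
    size decider                        ≤⟨ rounds-size n ⟩
    n * ((2 + n) * (2 + n) * 2)         ≤⟨ *-monoʳ-≤ n (*-monoˡ-≤ 2 (*-mono-≤ 2+n≤3n 2+n≤3n)) ⟩
    n * (3 * n * (3 * n) * 2)           ≡⟨ lemma n ⟩
    18 * n ^ 3                          ∎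
    where
    open ≤-Reasoning
    2+n≤3n : 2 + n ≤ 3 * n
    2+n≤3n = ≤-trans (+-monoˡ-≤ n (*-monoʳ-≤ 2 1≤n)) (≤-reflexive (+-comm (2 * n) n))
    lemma : ∀ n → n * (3 * n * (3 * n) * 2) ≡ 18 * (n * (n * (n * 1)))
    lemma = solve-∀

theorem4 : (∃[ c ] ∃[ n₀ ] (∀ n → n₀ ≤ n → D[ Path n ]≤ (c * n ^ 3)))
    × (∃[ a ] ∃[ b ] ∃[ n₀ ] (0 < a × 0 < b
    × (∀ n → n₀ ≤ n → C₀₁[ Path n ]≥ 2^[ n ^[ a / b ]])))
theorem4 =
  (18 , 1 , λ n 1≤n → let open Relaxation n in decider , decides , decider-size 1≤n) ,
  (1 , 3 , threshold , z<s , z<s , λ n n≥ →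
    let k , 120≤k , lower , n≤k³ = cube-root n n≥ in counting-lower n k 120≤k lower n≤k³)
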